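{- Let $q$ be a power of a prime and let $b,k \in \mathbb{N}$ with $k\ge 3$. Let $L_{b,k}$ be the number of linear bipermutive cellular automata (LBCA) $F:\mathbb{F}_q^{bk}\to\mathbb{F}_q^b$ whose associated $k$-dimensional hypercube $\mathcal{H}_F$ of order $q^b$ is a Latin hypercube. Then $L_{b,k}$ equals the number of paths of length $k-3$ over the de Bruijn graph $G_{det}$ of the determinant function $det:\mathbb{F}_q^{2b-1} \rightarrow \mathbb{F}_q$.
   Context: $\mathbb{N}$ denotes the positive integers, $\mathbb{F}_q$ is the finite field with $q$ elements, and $[N]=\{1,\ldots,N\}$. Latin hypercube: for a finite set $X$ of $N$ elements, a Latin hypercube of dimension $k$ and order $N$ over $X$ is a $k$-dimensional array with entries from $X$ such that, whenever any $k-1$ of the $k$ coordinates are fixed, letting the remaining coordinate vary yields a permutation of $X$ (each element of $X$ appears exactly once). Cellular automaton (CA): for $d\le n$ and $f:\mathbb{F}_q^d\to\mathbb{F}_q$, the CA of length $n$ and local rule $f$ is the map $F:\mathbb{F}_q^n\to\mathbb{F}_q^{n-d+1}$ with $F(x_1,\ldots,x_n) = (f(x_1,\ldots,x_d), f(x_2,\ldots,x_{d+1}),\ldots,f(x_{n-d+1},\ldots,x_n))$. LBCA: a CA whose local rule is of the form $f(x_1,\ldots,x_d)=x_1+a_2x_2+\cdots+a_{d-1}x_{d-1}+x_d$ with $a_2,\ldots,a_{d-1}\in\mathbb{F}_q$ (first and last coefficients equal to $1$). An LBCA $F:\mathbb{F}_q^{bk}\to\mathbb{F}_q^b$ has a local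 rule of $d=b(k-1)+1$ variables. Hypercube associated to a CA: the vectors in $\mathbb{F}_q^b$ are totally ordered, and $\Psi:[N]\to\mathbb{F}_q^b$, $N=q^b$, is the fixed monotone bijection. For a CA $F:\mathbb{F}_q^{bk}\to\mathbb{F}_q^b$ with local rule of $d=b(k-1)+1$ variables, $\mathcal{H}_F$ is the $k$-dimensional array of order $q^b$ with entries $\mathcal{H}_F(i_1,\ldots,i_k)=\Psi^{ -1}(F(\Psi(i_1)\,\|\,\cdots\,\|\,\Psi(i_k)))$ for $(i_1,\ldots,i_k)\in[N]^k$, where $\|$ is concatenation. Determinant function: for $a=(a_2,\ldots,a_{2b})\in\mathbb{F}_q^{2b-1}$ let $M_a$ be the $b\times b$ Toeplitz matrix whose $(r,c)$ entry is $a_{b+1+c-r}$ (first row $a_{b+1},\ldots,a_{2b}$; last row $a_2,\ldots,a_{b+1}$), and let $det(a)$ be the determinant of $M_a$. Its support is $supp(det)=\{a\in\mathbb{F}_q^{2b-1}: det(a)\ne 0\}$. De Bruijn graph: for words $u,v$ over an alphabet $A$ of length at least $s$, the $s$-fusion $u\odot v = z$ holds if and only if there exist $x\in A^s$ and words $u_0,v_0$ with $u=u_0x$, $v=xv_0$, $z=u_0xv_0$. $G_{det}=(V,E)$ is the directed graph (loops allowed) with $V=supp(det)$ and $(v_1,v_2)\in E$ if and only if there exists $z\in\mathbb{F}_q^{3b-1}$ with $z=v_1\odot v_2$, where $s=b-1$; i.e. the last $b-1$ coordinates of $v_1$ coincide with the first $b-1$ coordinates of $v_2$. A path of length $\ell$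 is a sequence of $\ell+1$ vertices (repetitions of vertices and edges allowed) in which each consecutive pair is an edge. -}

module Defs where

open import Algebra.Bundles using (CommutativeRing)
open import Algebra.Structures using (IsCommutativeRing)
import Algebra.Properties.Monoid.Sum as MonoidSum
import Algebra.Properties.Semiring.Exp as SemiringExp
open import Data.Fin.Base as Fin using (Fin; zero; suc; toℕ; fromℕ<; punchIn)
open import Data.Fin.Properties using (toℕ<n)
open import Data.List.Base as List using (List)
open import Data.Nat.Base as ℕ using (ℕ; zero; suc; NonZero; _∸_; s≤s)
import Data.Nat.Properties as ℕₚ
open import Data.Nat.Primality using (Prime)
open import Data.Product.Base using (Σ-syntax; ∃-syntax; _×_; proj₁; proj₂)
open import Data.Vec.Base as Vec using (Vec; _∷_; _∷ʳ_; _[_]≔_; lookup; tabulate; concat; toList)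
open import Data.Vec.Relation.Unary.Linked using (Linked)
open import Function.Base using (_∘_)
open import Function.Bundles using (Inverse; _↔_)
open import Function.Definitions using (Bijective)
open import Level using (0ℓ)
open import Relation.Binary.Bundles using (Setoid)
open import Relation.Binary.Core using (Rel)
import Relation.Binary.Construct.On as On
open import Relation.Binary.PropositionalEquality
  using (_≡_; _≢_; _≗_; cong; setoid; _→-setoid_)

------------------------------------------------------------------------
-- Cardinality and finite fields

HasCardinality : Setoid 0ℓ 0ℓ → ℕ → Set
HasCardinality S n = Inverse S (setoid (Fin n))

IsPrimePower : ℕ → Set
IsPrimePower q = ∃[ p ] ∃[ m ] Prime p × NonZero m × q ≡ p ℕ.^ m

-- Propositional equality loses no generality here: a finite setoid
-- field can be transported along its bijection with Fin q.

record FiniteField (q : ℕ) : Set₁ where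
  infixl 7 _*_
  infixl 6 _+_
  infix  8 -_
  field
    Carrier           : Set
    _+_ _*_           : Carrier → Carrier → Carrier
    -_                : Carrier → Carrier
    0# 1#             : Carrier
    isCommutativeRing : IsCommutativeRing _≡_ _+_ _*_ -_ 0# 1#
    0#≢1#             : 0# ≢ 1#
    inverse           : ∀ x → x ≢ 0# → ∃[ y ] x * y ≡ 1#
    finite            : Carrier ↔ Fin q

  commutativeRing : CommutativeRing 0ℓ 0ℓ
  commutativeRing = record { isCommutativeRing = isCommutativeRing }

------------------------------------------------------------------------
-- Determinants

module _ (R : CommutativeRing 0ℓ 0ℓ) where
  open CommutativeRing R hiding (zero)
  open MonoidSum +-monoid using (sum-syntax)
  open SemiringExp semiring using (_^_)

  -- Cofactor expansion along the first row.

  determinant : ∀ n → (Fin n → Fin n → Carrier) → Carrier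
  determinant zero    M = 1#
  determinant (suc n) M =
    ∑[ j < suc n ] ((- 1#) ^ toℕ j * M zero j
                    * determinant n (λ r c → M (suc r) (punchIn j c)))

------------------------------------------------------------------------
-- Latin hypercubes

Hypercube : ℕ → ℕ → Set → Set
Hypercube k N X = Vec (Fin N) k → X

-- The entry of i at coordinate j is overwritten by x, so only the other
-- k - 1 entries of i are fixed.

IsLatinHypercube : ∀ {k N X} → Hypercube k N X → Set
IsLatinHypercube {k} {N} H =
  ∀ (j : Fin k) (i : Vec (Fin N) k) → Bijective _≡_ _≡_ (λ x → H (i [ j ]≔ x))

------------------------------------------------------------------------
-- Cellular automata

window-bound : ∀ {m d n} → m ℕ.+ d ≡ suc n →
               (i : Fin m) (j : Fin d) → toℕ i ℕ.+ toℕ j ℕ.< n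
window-bound {m} {d} eq i j = ℕₚ.≤-pred (begin
  suc (suc (toℕ i ℕ.+ toℕ j)) ≡⟨ ℕₚ.+-suc (suc (toℕ i)) (toℕ j) ⟨
  suc (toℕ i) ℕ.+ suc (toℕ j) ≤⟨ ℕₚ.+-mono-≤ (toℕ<n i) (toℕ<n j) ⟩
  m ℕ.+ d                     ≡⟨ eq ⟩
  suc _                       ∎)
  where open ℕₚ.≤-Reasoning

-- The equation m + d ≡ n + 1 says m = n - d + 1 without truncated
-- subtraction; for m ≥ 1 it also gives d ≤ n.

cellularAutomaton : ∀ {A : Set} {m d n} → m ℕ.+ d ≡ suc n →
                    (Vec A d → A) → Vec A n → Vec A m
cellularAutomaton eq f x =
  tabulate λ i → f (tabulate λ j → lookup x (fromℕ< (window-bound eq i j)))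

------------------------------------------------------------------------
-- Directed graphs and fusion of words

record Digraph : Set₁ where
  field
    Vertex : Setoid 0ℓ 0ℓ
    Edge   : Rel (Setoid.Carrier Vertex) 0ℓ

-- Two paths are equal when their vertices agree in every position; the
-- evidence for the edges is irrelevant.

Paths : Digraph → ℕ → Setoid 0ℓ 0ℓ
Paths G ℓ =
  On.setoid {B = Σ[ vs ∈ Vec V (suc ℓ) ] Linked Edge vs} (≋-setoid (suc ℓ)) proj₁
  where
  open Digraph G
  open import Data.Vec.Relation.Binary.Equality.Setoid Vertex using (≋-setoid)
  V = Setoid.Carrier Vertex

-- Fusion s u v z is u ⊙ v = z with an overlap of length s.

Fusion : {A : Set} → ℕ → List A → List A → List A → Set
Fusion s u v z = ∃[ x ] ∃[ u₀ ] ∃[ v₀ ]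
  List.length x ≡ s × u ≡ u₀ List.++ x × v ≡ x List.++ v₀ ×
  z ≡ u₀ List.++ x List.++ v₀

toeplitz-bound : ∀ {b} (r c : Fin b) →
                 (b ℕ.+ toℕ c) ∸ suc (toℕ r) ℕ.< 2 ℕ.* b ∸ 1
toeplitz-bound {suc b} r c = begin-strict
  (b ℕ.+ toℕ c) ∸ toℕ r   ≤⟨ ℕₚ.m∸n≤m (b ℕ.+ toℕ c) (toℕ r) ⟩
  b ℕ.+ toℕ c             <⟨ ℕₚ.+-monoʳ-< b (toℕ<n c) ⟩
  b ℕ.+ suc b             ≡⟨ cong (b ℕ.+_) (ℕₚ.+-identityʳ (suc b)) ⟨
  b ℕ.+ (suc b ℕ.+ 0)     ∎
  where
  open ℕₚ.≤-Reasoning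

module _ {q : ℕ} (𝔽 : FiniteField q) where
  open FiniteField 𝔽
  open CommutativeRing commutativeRing using (+-monoid)
  open MonoidSum +-monoid using (sum-syntax)

  ----------------------------------------------------------------------
  -- Linear bipermutive cellular automata

  -- The argument is (a₂ , … , a_{d-1}), where d = 2 + e.

  bipermutiveRule : ∀ {e} → Vec Carrier e → Vec Carrier (2 ℕ.+ e) → Carrier
  bipermutiveRule {e} a x =
    ∑[ j < 2 ℕ.+ e ] (lookup (1# ∷ (a ∷ʳ 1#)) j * lookup x j)

  -- The number of variables 2 + e is determined by n and m.

  IsLBCA : ∀ {n m} → (Vec Carrier n → Vec Carrier m) → Set
  IsLBCA {n} {m} F =
    ∃[ e ] Σ[ eq ∈ m ℕ.+ (2 ℕ.+ e) ≡ suc n ] Σ[ a ∈ Vec Carrier e ]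
      F ≗ cellularAutomaton eq (bipermutiveRule a)

  associatedHypercube : ∀ {b k} → Fin (q ℕ.^ b) ↔ Vec Carrier b →
                        (Vec Carrier (k ℕ.* b) → Vec Carrier b) →
                        Hypercube k (q ℕ.^ b) (Fin (q ℕ.^ b))
  associatedHypercube Ψ F i = Ψ.from (F (concat (Vec.map Ψ.to i)))
    where module Ψ = Inverse Ψ

  -- Automata are compared as maps, not as local rules.

  LatinLBCA : ∀ b k → Fin (q ℕ.^ b) ↔ Vec Carrier b → Setoid 0ℓ 0ℓ
  LatinLBCA b k Ψ = On.setoid
    {B = Σ[ F ∈ (Vec Carrier (k ℕ.* b) → Vec Carrier b) ]
           IsLBCA F × IsLatinHypercube (associatedHypercube {b} {k} Ψ F)}
    (Vec Carrier (k ℕ.* b) →-setoid Vec Carrier b) proj₁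

  ----------------------------------------------------------------------
  -- The de Bruijn graph of the Toeplitz determinant

  -- With a = (a₂ , … , a_{2b}), the coordinate a_{b+1+c-r} has 0-based
  -- position b + c - r - 1, and c - r is the same whether rows and
  -- columns are counted from 0 or from 1. The subtraction is never
  -- truncated, as r < b.

  toeplitz : ∀ {b} → Vec Carrier (2 ℕ.* b ∸ 1) → Fin b → Fin b → Carrier
  toeplitz a r c = lookup a (fromℕ< (toeplitz-bound r c))

  det : ∀ b → Vec Carrier (2 ℕ.* b ∸ 1) → Carrier
  det b a = determinant commutativeRing b (toeplitz a)

  Supp : ∀ b → Set
  Supp b = Σ[ a ∈ Vec Carrier (2 ℕ.* b ∸ 1) ] det b a ≢ 0#

  deBruijnGraph : ℕ → Digraph
  deBruijnGraph b = record
    { Vertex = On.setoid {B = Supp b} (setoid (Vec Carrier (2 ℕ.* b ∸ 1))) proj₁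
    ; Edge   = λ v₁ v₂ → Σ[ z ∈ Vec Carrier (3 ℕ.* b ∸ 1) ]
        Fusion (b ∸ 1) (toList (proj₁ v₁)) (toList (proj₁ v₂)) (toList z)
    }

{-# OPTIONS --safe #-}

-- As a matrix, an LBCA is a banded Toeplitz matrix with b rows, and moving along
-- the j-th axis of the hypercube varies the j-th block of b columns. Hence the
-- hypercube is Latin iff all k square blocks are nonsingular. The two outer
-- blocks are unitriangular; the block μ + 1 in between is the Toeplitz matrix of
-- the window of length 2b - 1 at offset μ b in (a₂ , … , a_{d-1}). Consecutive
-- windows overlap in b - 1 letters, so the windows form a path of length k - 3,
-- and a path glues to exactly one word of coefficients.
--
-- A matrix over a finite field is singular iff it has a nontrivial kernel. Since
-- the determinant expands along the first row, only column operations are used: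
-- Cramer's rule x_c det M = det (M with column c replaced by M x) handles kernel
-- vectors, and with M x = e₀ it reduces an injective M to a minor.

module Submission where

open import Defs
import Algebra.Properties.Ring as RingProperties
import Algebra.Properties.Semiring.Exp as SemiringExp
import Algebra.Properties.Semiring.Sum as SemiringSum
import Algebra.Solver.Ring.NaturalCoefficients.Default as RingSolver
open import Algebra.Bundles using (CommutativeRing)
open import Data.Empty using (⊥-elim)
open import Data.Fin.Base as Fin
  using (Fin; zero; suc; toℕ; fromℕ; fromℕ<; inject₁; punchIn; punchOut)
import Data.Fin.Properties as Finₚ
open import Data.List.Base as List using (List)
import Data.List.Properties as Listₚ
open import Data.Nat.Base as ℕ
  using (ℕ; zero; suc; NonZero; _≤_; _<_; z≤n; s≤s; _∸_; _^_)
import Data.Nat.Properties as ℕₚ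
open import Data.Product.Base using (_×_; _,_; proj₁; proj₂; ∃-syntax; Σ-syntax)
open import Data.Product.Function.NonDependent.Propositional using (_×-↔_)
open import Data.Sum.Base using (_⊎_; inj₁; inj₂)
open import Data.Vec.Base as Vec
  using (Vec; []; _∷_; _∷ʳ_; _[_]≔_; lookup; tabulate; toList; concat; replicate)
import Data.Vec.Properties as Vecₚ
open import Data.Vec.Functional using (Vector; updateAt; insertAt)
open import Data.Vec.Functional.Properties
  using (updateAt-updates; updateAt-minimal; insertAt-lookup; insertAt-punchIn)
open import Data.Vec.Relation.Binary.Pointwise.Inductive as Pointwise using (Pointwise; []; _∷_)
open import Data.Vec.Relation.Unary.Linked using (Linked; []; [-]; _∷_)
open import Function.Base using (_∘_; const)
open import Function.Bundles using (Inverse; Injection; _↔_; mk↔ₛ′)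
open import Function.Consequences.Propositional using (strictlySurjective⇒surjective)
import Function.Construct.Composition as Composition
open Composition using (_↔-∘_)
open import Function.Construct.Symmetry using (↔-sym)
open import Function.Definitions using (Injective)
open import Function.Properties.Inverse using (↔⇒↣)
open import Level using (0ℓ)
open import Relation.Binary.Bundles using (Setoid)
import Relation.Binary.Construct.On as On
open import Relation.Binary.Core using (Rel; REL)
open import Relation.Binary.Definitions using (DecidableEquality; Monotonic₁; tri<; tri≈; tri>)
open import Relation.Binary.PropositionalEquality as ≡
  using (_≡_; _≢_; _≗_; refl; sym; trans; cong; cong₂; subst; module ≡-Reasoning)
import Relation.Binary.Reasoning.Setoid as SetoidReasoning
open import Relation.Binary.Structures using (IsTotalOrder)
open import Relation.Nullary using (yes; no)
open import Relation.Nullary.Decidable using (via-injection; ¬?)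
open import Relation.Unary using (Decidable)

-- The two sets are never compared directly. Each is put in bijection with `Rules`, the coefficient
-- words all of whose windows are nonsingular; this is a decidable subset of a finite set, so it has
-- a cardinality, and that is the common `L`. A Latin hypercube asks for bijections along every
-- axis, but only injectivity carries content, because an injective self-map of `Fin (q ^ b)` is
-- surjective. By linearity, injectivity on all lines parallel to one axis is a single condition on
-- a kernel, so everything up to the middle blocks is phrased with kernels, and determinants enter
-- only there. In characteristic 2 a change of sign under swapping columns would not force a
-- determinant with two equal columns to vanish. Hence the vanishing is proved by cancellation for
-- adjacent columns and then carried over to distant ones.

-- Determinants over a commutative ring: column operations and Cramer's rule

-- Compares the minors without column `i` and without column `i + 1`: they list the same columns,
-- except that one shows `i + 1` where the other shows `i`. If these two columns are equal, so are
-- the minors.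
punchIn-adjacent : ∀ {n} (i : Fin n) (j : Fin n) →
  punchIn (inject₁ i) j ≡ punchIn (suc i) j ⊎
  (punchIn (inject₁ i) j ≡ suc i × punchIn (suc i) j ≡ inject₁ i)
punchIn-adjacent zero    zero    = inj₂ (refl , refl)
punchIn-adjacent zero    (suc j) = inj₁ refl
punchIn-adjacent (suc i) zero    = inj₁ refl
punchIn-adjacent (suc i) (suc j) with punchIn-adjacent i j
... | inj₁ eq         = inj₁ (cong suc eq)
... | inj₂ (eq , eq′) = inj₂ (cong suc eq , cong suc eq′)

-- Two adjacent columns stay adjacent in a minor that keeps both, so the induction on adjacent equal
-- columns can descend to it.
punchIn-hits-adjacent : ∀ {n} (i : Fin (suc n)) (j : Fin (suc (suc n))) →
  j ≢ inject₁ i → j ≢ suc i →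
  ∃[ i′ ] punchIn j (inject₁ {n} i′) ≡ inject₁ i × punchIn j (suc i′) ≡ suc i
punchIn-hits-adjacent zero    zero    j≢i _ = ⊥-elim (j≢i refl)
punchIn-hits-adjacent (suc i) zero    _   _ = i , refl , refl
punchIn-hits-adjacent zero    (suc zero)    _ j≢si = ⊥-elim (j≢si refl)
punchIn-hits-adjacent {suc n} zero (suc (suc j)) _ _ = zero , refl , refl
punchIn-hits-adjacent {suc n} (suc i) (suc j) j≢i j≢si
  with i′ , eq , eq′ ← punchIn-hits-adjacent i j (j≢i ∘ cong suc) (j≢si ∘ cong suc)
  = suc i′ , cong suc eq , cong suc eq′

module ColumnOperations (R : CommutativeRing 0ℓ 0ℓ) where
  open CommutativeRing R hiding (zero)
    renaming (refl to ≈-refl; sym to ≈-sym; trans to ≈-trans)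
  open SemiringSum semiring
  open SemiringExp semiring using () renaming (_^_ to _^ᴿ_)
  open SetoidReasoning setoid

  open RingSolver commutativeSemiring using (solve; _:+_; _:*_; _:=_; con)

  Matrix : ℕ → Set
  Matrix n = Fin n → Fin n → Carrier

  infixr 8 _·_

  _·_ : ∀ {n} → Matrix n → Vector Carrier n → Vector Carrier n
  (M · x) r = ∑[ c < _ ] (M r c * x c)

  minor : ∀ {n} → Matrix (suc n) → Fin (suc n) → Matrix n
  minor M j r c = M (suc r) (punchIn j c)

  sum-zero : ∀ {n} (t : Vector Carrier n) → (∀ j → t j ≈ 0#) → sum t ≈ 0#
  sum-zero {n} t t≈0 = ≈-trans (sum-cong-≋ t≈0) (sum-replicate-zero n)

  sum-single : ∀ {n} c (t : Vector Carrier n) → (∀ j → j ≢ c → t j ≈ 0#) → sum t ≈ t c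
  sum-single {suc n} c t t≈0 = begin
    sum t                      ≈⟨ sum-remove {i = c} t ⟩
    t c + sum (t ∘ punchIn c)  ≈⟨ +-congˡ (sum-zero _ λ j → t≈0 _ (Finₚ.punchInᵢ≢i c j)) ⟩
    t c + 0#                   ≈⟨ +-identityʳ _ ⟩
    t c                        ∎

  sum-cancel-adjacent : ∀ {n} (i : Fin n) (t : Vector Carrier (suc n)) →
    t (inject₁ i) + t (suc i) ≈ 0# →
    (∀ j → j ≢ inject₁ i → j ≢ suc i → t j ≈ 0#) → sum t ≈ 0#
  sum-cancel-adjacent {suc n} zero t eq t≈0 = begin
    t zero + (t (suc zero) + sum rest) ≈⟨ +-assoc _ _ _ ⟨
    t zero + t (suc zero) + sum rest
      ≈⟨ +-cong eq (sum-zero rest λ j → t≈0 (suc (suc j)) (λ ()) (λ ())) ⟩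
    0# + 0#                                       ≈⟨ +-identityˡ _ ⟩
    0#                                            ∎
    where
    rest : Vector Carrier n
    rest j = t (suc (suc j))
  sum-cancel-adjacent (suc i) t eq t≈0 = begin
    t zero + sum (t ∘ suc)
      ≈⟨ +-cong (t≈0 zero (λ ()) (λ ()))
                (sum-cancel-adjacent i (t ∘ suc) eq λ j j≢i j≢si →
                   t≈0 (suc j) (j≢i ∘ Finₚ.suc-injective) (j≢si ∘ Finₚ.suc-injective)) ⟩
    0# + 0#                 ≈⟨ +-identityˡ _ ⟩
    0#                      ∎

  det-cong : ∀ n {M N : Matrix n} → (∀ r c → M r c ≈ N r c) →
             determinant R n M ≈ determinant R n N
  det-cong zero    eq = ≈-refl
  det-cong (suc n) eq = sum-cong-≋ λ j →
    *-cong (*-congˡ {(- 1#) ^ᴿ toℕ j} (eq zero j)) (det-cong n λ r c → eq (suc r) (punchIn j c))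

  -- In the expansion, the term at `c` is linear through its entry and has equal minors; every other
  -- term has equal entries and a minor that is linear in the shifted column `punchOut j≢c`.
  -- Entrywise hypotheses, rather than updated matrices, are inherited by minors.
  det-linear : ∀ n c x y {A M N : Matrix n} →
    (∀ r → A r c ≈ x * M r c + y * N r c) →
    (∀ r j → j ≢ c → A r j ≈ M r j) → (∀ r j → j ≢ c → A r j ≈ N r j) →
    determinant R n A ≈ x * determinant R n M + y * determinant R n N
  det-linear (suc n) c x y {A} {M} {N} lin A≈M A≈N = begin
    ∑[ j < suc n ] term A j
      ≈⟨ sum-cong-≋ term-linear ⟩
    ∑[ j < suc n ] (x * term M j + y * term N j)
      ≈⟨ ∑-distrib-+ (λ j → x * term M j) (λ j → y * term N j) ⟩
    ∑[ j < suc n ] (x * term M j) + ∑[ j < suc n ] (y * term N j)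
      ≈⟨ +-cong (*-distribˡ-sum x (term M)) (*-distribˡ-sum y (term N)) ⟨
    x * determinant R (suc n) M + y * determinant R (suc n) N ∎
    where
    term : Matrix (suc n) → Vector Carrier (suc n)
    term M j = (- 1#) ^ᴿ toℕ j * M zero j * determinant R n (minor M j)

    term-linear : ∀ j → term A j ≈ x * term M j + y * term N j
    term-linear j with j Finₚ.≟ c
    ... | yes refl = begin
      s * A zero j * D A
        ≈⟨ *-congʳ (*-congˡ (lin zero)) ⟩
      s * (x * M zero j + y * N zero j) * D A
        ≈⟨ distribute s x y (M zero j) (N zero j) (D A) ⟩
      x * (s * M zero j * D A) + y * (s * N zero j * D A)
        ≈⟨ +-cong (*-congˡ (*-congˡ (det-cong n λ r k → A≈M (suc r) _ (Finₚ.punchInᵢ≢i j k))))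
                  (*-congˡ (*-congˡ (det-cong n λ r k → A≈N (suc r) _ (Finₚ.punchInᵢ≢i j k)))) ⟩
      x * term M j + y * term N j ∎
      where
      s = (- 1#) ^ᴿ toℕ j
      D = λ B → determinant R n (minor B j)
      distribute : ∀ s x y m n d → s * (x * m + y * n) * d ≈ x * (s * m * d) + y * (s * n * d)
      distribute = solve 6 (λ s x y m n d →
        s :* (x :* m :+ y :* n) :* d := x :* (s :* m :* d) :+ y :* (s :* n :* d)) ≈-refl
    ... | no j≢c = begin
      s * A zero j * D A
        ≈⟨ *-congˡ (det-linear n c′ x y
             (λ r → subst (λ k → A (suc r) k ≈ x * M (suc r) k + y * N (suc r) k) (sym hit) (lin (suc r)))
             (λ r k k≢c′ → A≈M (suc r) _ (miss k≢c′))
             (λ r k k≢c′ → A≈N (suc r) _ (miss k≢c′))) ⟩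
      s * A zero j * (x * D M + y * D N)
        ≈⟨ distribute s (A zero j) x y (D M) (D N) ⟩
      x * (s * A zero j * D M) + y * (s * A zero j * D N)
        ≈⟨ +-cong (*-congˡ (*-congʳ (*-congˡ (A≈M zero j j≢c))))
                  (*-congˡ (*-congʳ (*-congˡ (A≈N zero j j≢c)))) ⟩
      x * term M j + y * term N j ∎
      where
      s = (- 1#) ^ᴿ toℕ j
      D = λ B → determinant R n (minor B j)
      c′ = punchOut j≢c
      hit : punchIn j c′ ≡ c
      hit = Finₚ.punchIn-punchOut j≢c
      miss : ∀ {k} → k ≢ c′ → punchIn j k ≢ c
      miss k≢c′ eq = k≢c′ (Finₚ.punchIn-injective j _ _ (trans eq (sym hit)))
      distribute : ∀ s a x y d e → s * a * (x * d + y * e) ≈ x * (s * a * d) + y * (s * a * e)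
      distribute = solve 6 (λ s a x y d e →
        s :* a :* (x :* d :+ y :* e) := x :* (s :* a :* d) :+ y :* (s :* a :* e)) ≈-refl

  -- Linearity with `M` in all three places and both scalars 0: a zero column is `0#` times itself
  -- plus `0#` times itself.
  det-zeroColumn : ∀ n c {M : Matrix n} → (∀ r → M r c ≈ 0#) → determinant R n M ≈ 0#
  det-zeroColumn n c {M} M≈0 = begin
    d                 ≈⟨ det-linear n c 0# 0# (λ r → ≈-trans (M≈0 r) (≈-sym (vanish (M r c))))
                           (λ _ _ _ → ≈-refl) (λ _ _ _ → ≈-refl) ⟩
    0# * d + 0# * d   ≈⟨ vanish d ⟩
    0#                ∎
    where
    d = determinant R n M
    vanish : ∀ x → 0# * x + 0# * x ≈ 0#
    vanish x = ≈-trans (+-cong (zeroˡ x) (zeroˡ x)) (+-identityˡ 0#)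

  -- The terms at the two columns have equal entries, equal minors and opposite signs, so they
  -- cancel. Every other minor still contains both columns next to each other and vanishes by
  -- induction.
  det-adjacentColumns : ∀ n {M : Matrix (suc n)} (i : Fin n) →
    (∀ r → M r (inject₁ i) ≈ M r (suc i)) → determinant R (suc n) M ≈ 0#
  det-adjacentColumns (suc n) {M} i eq = sum-cancel-adjacent i term cancel vanish
    where
    D : Fin (suc (suc n)) → Carrier
    D j = determinant R (suc n) (minor M j)

    term : Vector Carrier (suc (suc n))
    term j = (- 1#) ^ᴿ toℕ j * M zero j * D j

    same-entry : ∀ r c → M r (punchIn (inject₁ i) c) ≈ M r (punchIn (suc i) c)
    same-entry r c with punchIn-adjacent i c
    ... | inj₁ p       = reflexive (cong (M r) p)
    ... | inj₂ (p , p′) = begin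
      M r (punchIn (inject₁ i) c) ≡⟨ cong (M r) p ⟩
      M r (suc i)                 ≈⟨ eq r ⟨
      M r (inject₁ i)             ≡⟨ cong (M r) p′ ⟨
      M r (punchIn (suc i) c)     ∎

    cancel : term (inject₁ i) + term (suc i) ≈ 0#
    cancel = begin
      (- 1#) ^ᴿ toℕ (inject₁ i) * M zero (inject₁ i) * D (inject₁ i) + term (suc i)
        ≈⟨ +-congʳ (*-cong (*-cong (reflexive (cong ((- 1#) ^ᴿ_) (Finₚ.toℕ-inject₁ i))) (eq zero))
                           (det-cong (suc n) λ r → same-entry (suc r))) ⟩
      s * m * D (suc i) + (- 1#) * s * m * D (suc i)
        ≈⟨ collect s m (D (suc i)) (- 1#) ⟩
      (1# + - 1#) * (s * m * D (suc i))
        ≈⟨ *-congʳ (-‿inverseʳ 1#) ⟩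
      0# * (s * m * D (suc i))
        ≈⟨ zeroˡ _ ⟩
      0# ∎
      where
      s = (- 1#) ^ᴿ toℕ i
      m = M zero (suc i)
      collect : ∀ s m d z → s * m * d + z * s * m * d ≈ (1# + z) * (s * m * d)
      collect = solve 4 (λ s m d z →
        s :* m :* d :+ z :* s :* m :* d := (con 1 :+ z) :* (s :* m :* d)) ≈-refl

    vanish : ∀ j → j ≢ inject₁ i → j ≢ suc i → term j ≈ 0#
    vanish j j≢i j≢si with i′ , p , p′ ← punchIn-hits-adjacent i j j≢i j≢si =
      ≈-trans (*-congˡ (det-adjacentColumns n {minor M j} i′ λ r → begin
        M (suc r) (punchIn j (inject₁ i′)) ≡⟨ cong (M (suc r)) p ⟩
        M (suc r) (inject₁ i)              ≈⟨ eq (suc r) ⟩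
        M (suc r) (suc i)                  ≡⟨ cong (M (suc r)) p′ ⟨
        M (suc r) (punchIn j (suc i′))     ∎)) (zeroʳ _)

  replace : ∀ {n} → Matrix n → Fin n → Vector Carrier n → Matrix n
  replace M c u r = updateAt (M r) c (const (u r))

  replace-at : ∀ {n} (M : Matrix n) c u r → replace M c u r c ≡ u r
  replace-at M c u r = updateAt-updates c (M r)

  replace-off : ∀ {n} (M : Matrix n) c u r {j} → j ≢ c → replace M c u r j ≡ M r j
  replace-off M c u r {j} j≢c = updateAt-minimal j c (M r) j≢c

  replace-cong : ∀ {n} {M N : Matrix n} c {u v} → (∀ r → u r ≈ v r) →
    (∀ r j → j ≢ c → M r j ≈ N r j) → ∀ r j → replace M c u r j ≈ replace N c v r j
  replace-cong {M = M} {N} c {u} {v} u≈v M≈N r j with j Finₚ.≟ c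
  ... | yes refl = begin
    replace M c u r c ≡⟨ replace-at M c u r ⟩
    u r               ≈⟨ u≈v r ⟩
    v r               ≡⟨ replace-at N c v r ⟨
    replace N c v r c ∎
  ... | no j≢c = begin
    replace M c u r j ≡⟨ replace-off M c u r j≢c ⟩
    M r j             ≈⟨ M≈N r j j≢c ⟩
    N r j             ≡⟨ replace-off N c v r j≢c ⟨
    replace N c v r j ∎

  det-replace-linear : ∀ {n} (M : Matrix n) c x y u v →
    determinant R n (replace M c λ r → x * u r + y * v r)
      ≈ x * determinant R n (replace M c u) + y * determinant R n (replace M c v)
  det-replace-linear {n} M c x y u v = det-linear n c x y
    (λ r → reflexive (trans (replace-at M c w r)
      (sym (cong₂ (λ a b → x * a + y * b) (replace-at M c u r) (replace-at M c v r)))))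
    (λ r j j≢c → reflexive (trans (replace-off M c w r j≢c) (sym (replace-off M c u r j≢c))))
    (λ r j j≢c → reflexive (trans (replace-off M c w r j≢c) (sym (replace-off M c v r j≢c))))
    where
    w = λ r → x * u r + y * v r

  -- The number `k` of summands is independent of the size `n`, so that the induction shortens the
  -- sum and leaves the matrix alone.
  det-replace-sum : ∀ {n} (M : Matrix n) c k (x : Vector Carrier k) (U : Fin k → Vector Carrier n) →
    determinant R n (replace M c λ r → ∑[ j < k ] (x j * U j r))
      ≈ ∑[ j < k ] (x j * determinant R n (replace M c (U j)))
  det-replace-sum {n} M c zero x U =
    det-zeroColumn n c λ r → reflexive (replace-at M c _ r)
  det-replace-sum {n} M c (suc k) x U = begin
    determinant R n (replace M c λ r → x zero * U zero r + S r)
      ≈⟨ det-cong n (replace-cong c (λ r → +-congˡ (≈-sym (*-identityˡ (S r)))) λ _ _ _ → ≈-refl) ⟩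
    determinant R n (replace M c λ r → x zero * U zero r + 1# * S r)
      ≈⟨ det-replace-linear M c (x zero) 1# (U zero) S ⟩
    x zero * determinant R n (replace M c (U zero)) + 1# * determinant R n (replace M c S)
      ≈⟨ +-congˡ (≈-trans (*-identityˡ _) (det-replace-sum M c k (x ∘ suc) (U ∘ suc))) ⟩
    ∑[ j < suc k ] (x j * determinant R n (replace M c (U j))) ∎
    where
    S : Vector Carrier n
    S r = ∑[ j < k ] (x (suc j) * U (suc j) r)

  -- At distance at least 2, swapping column j with its left neighbour h brings the
  -- equal columns closer. B w z has w at h and z at j; it is additive in both and
  -- vanishes for w = z, so B v u is determined by B u v, the induction hypothesis.

  det-equalColumns-< : ∀ g {n} {M : Matrix n} i j → toℕ j ≡ suc (g ℕ.+ toℕ i) →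
    (∀ r → M r i ≈ M r j) → determinant R n M ≈ 0#
  det-equalColumns-< zero {suc n} {M} i (suc j) gap eq = det-adjacentColumns n {M} j λ r →
    ≈-trans (reflexive (cong (M r) (Finₚ.toℕ-injective (trans (Finₚ.toℕ-inject₁ j) (ℕₚ.suc-injective gap)))))
          (eq r)
  det-equalColumns-< (suc g) {suc n} {M} i j@(suc j′) gap eq = begin
    determinant R (suc n) M   ≈⟨ det-cong (suc n) unchanged ⟩
    B v u                     ≈⟨ +-identityʳ _ ⟨
    B v u + 0#                ≈⟨ +-congˡ (alternating v) ⟨
    B v u + B v v             ≈⟨ additiveʳ v u v ⟨
    B v (u ⊕ v)               ≈⟨ +-identityˡ _ ⟨
    0# + B v (u ⊕ v)          ≈⟨ +-congʳ (≈-trans (+-cong (alternating u) equal) (+-identityˡ 0#)) ⟨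
    B u u + B u v + B v (u ⊕ v) ≈⟨ +-congʳ (additiveʳ u u v) ⟨
    B u (u ⊕ v) + B v (u ⊕ v) ≈⟨ additiveˡ u v (u ⊕ v) ⟨
    B (u ⊕ v) (u ⊕ v)         ≈⟨ alternating (u ⊕ v) ⟩
    0#                        ∎
    where
    h = inject₁ j′
    h-gap : toℕ h ≡ suc (g ℕ.+ toℕ i)
    h-gap = trans (Finₚ.toℕ-inject₁ j′) (ℕₚ.suc-injective gap)
    h≢j : h ≢ j
    h≢j p = ℕₚ.1+n≢n (sym (trans (sym (Finₚ.toℕ-inject₁ j′)) (cong toℕ p)))
    i≢h : i ≢ h
    i≢h p = ℕₚ.m≢1+n+m (toℕ i) (trans (cong toℕ p) h-gap)
    i≢j : i ≢ j
    i≢j p = ℕₚ.m≢1+n+m (toℕ i) (trans (cong toℕ p) gap)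

    u v : Vector Carrier (suc n)
    u r = M r j
    v r = M r h

    _⊕_ : Vector Carrier (suc n) → Vector Carrier (suc n) → Vector Carrier (suc n)
    (w ⊕ z) r = 1# * w r + 1# * z r

    B′ : Vector Carrier (suc n) → Vector Carrier (suc n) → Matrix (suc n)
    B′ w z = replace (replace M h w) j z

    B : Vector Carrier (suc n) → Vector Carrier (suc n) → Carrier
    B w z = determinant R (suc n) (B′ w z)

    at-h : ∀ w z r → B′ w z r h ≡ w r
    at-h w z r = trans (replace-off (replace M h w) j z r h≢j) (replace-at M h w r)

    at-i : ∀ w z r → B′ w z r i ≡ M r i
    at-i w z r = trans (replace-off (replace M h w) j z r i≢j) (replace-off M h w r i≢h)

    alternating : ∀ w → B w w ≈ 0#
    alternating w = det-adjacentColumns n {B′ w w} j′ λ r →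
      reflexive (trans (at-h w w r) (sym (replace-at (replace M h w) j w r)))

    unit : ∀ x y → 1# * x + 1# * y ≈ x + y
    unit x y = +-cong (*-identityˡ x) (*-identityˡ y)

    additiveʳ : ∀ w z z′ → B w (z ⊕ z′) ≈ B w z + B w z′
    additiveʳ w z z′ = ≈-trans (det-replace-linear (replace M h w) j 1# 1# z z′) (unit _ _)

    off-h : ∀ w w′ z r k → k ≢ h → B′ w z r k ≈ B′ w′ z r k
    off-h w w′ z r k k≢h = reflexive (helper k k≢h)
      where
      helper : ∀ k → k ≢ h → B′ w z r k ≡ B′ w′ z r k
      helper k k≢h with k Finₚ.≟ j
      ... | yes refl = trans (replace-at (replace M h w) k z r) (sym (replace-at (replace M h w′) k z r))
      ... | no k≢j = trans (trans (replace-off (replace M h w) j z r k≢j) (replace-off M h w r k≢h))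
        (sym (trans (replace-off (replace M h w′) j z r k≢j) (replace-off M h w′ r k≢h)))

    additiveˡ : ∀ w w′ z → B (w ⊕ w′) z ≈ B w z + B w′ z
    additiveˡ w w′ z = ≈-trans
      (det-linear (suc n) h 1# 1#
        (λ r → reflexive (trans (at-h (w ⊕ w′) z r)
          (sym (cong₂ (λ a b → 1# * a + 1# * b) (at-h w z r) (at-h w′ z r)))))
        (off-h (w ⊕ w′) w z) (off-h (w ⊕ w′) w′ z))
      (unit _ _)

    equal : B u v ≈ 0#
    equal = det-equalColumns-< g {M = B′ u v} i h h-gap λ r → begin
      B′ u v r i ≡⟨ at-i u v r ⟩
      M r i      ≈⟨ eq r ⟩
      M r j      ≡⟨ at-h u v r ⟨
      B′ u v r h ∎

    unchanged : ∀ r k → M r k ≈ B′ v u r k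
    unchanged r k with k Finₚ.≟ j | k Finₚ.≟ h
    ... | yes refl | _ = reflexive (sym (replace-at (replace M h v) k u r))
    ... | no k≢j | yes refl = reflexive (sym (at-h v u r))
    ... | no k≢j | no k≢h = reflexive (sym
      (trans (replace-off (replace M h v) j u r k≢j) (replace-off M h v r k≢h)))

  det-equalColumns : ∀ {n} {M : Matrix n} {i j} → i ≢ j →
    (∀ r → M r i ≈ M r j) → determinant R n M ≈ 0#
  det-equalColumns {M = M} {i} {j} i≢j eq with ℕₚ.<-cmp (toℕ i) (toℕ j)
  ... | tri≈ _ p _ = ⊥-elim (i≢j (Finₚ.toℕ-injective p))
  ... | tri< i<j _ _ = det-equalColumns-< _ {M = M} i j
    (sym (trans (sym (ℕₚ.+-suc _ _)) (ℕₚ.m∸n+n≡m i<j))) eq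
  ... | tri> _ _ j<i = det-equalColumns-< _ {M = M} j i
    (sym (trans (sym (ℕₚ.+-suc _ _)) (ℕₚ.m∸n+n≡m j<i))) (≈-sym ∘ eq)

  cramer : ∀ {n} (M : Matrix n) x c →
    determinant R n (replace M c (M · x)) ≈ x c * determinant R n M
  cramer {n} M x c = begin
    determinant R n (replace M c (M · x))
      ≈⟨ det-cong n (replace-cong c (λ r → sum-cong-≋ λ j → *-comm (M r j) (x j)) λ _ _ _ → ≈-refl) ⟩
    determinant R n (replace M c λ r → ∑[ j < n ] (x j * M r j))
      ≈⟨ det-replace-sum M c n x col ⟩
    ∑[ j < n ] (x j * determinant R n (replace M c (col j)))
      -- For `j ≢ c` the column `col j` now stands both at `j` and at `c`.
      ≈⟨ sum-single c _ (λ j j≢c → ≈-trans (*-congˡ (det-equalColumns {M = replace M c (col j)} j≢c λ r →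
           reflexive (trans (replace-off M c (col j) r j≢c) (sym (replace-at M c (col j) r))))) (zeroʳ _)) ⟩
    x c * determinant R n (replace M c (col c))
      ≈⟨ *-congˡ (det-cong n restored) ⟩
    x c * determinant R n M ∎
    where
    col : Fin n → Vector Carrier n
    col j r = M r j

    restored : ∀ r j → replace M c (col c) r j ≈ M r j
    restored r j with j Finₚ.≟ c
    ... | yes refl = reflexive (replace-at M c (col c) r)
    ... | no j≢c     = reflexive (replace-off M c (col c) r j≢c)

  ·-combine : ∀ {n} (M : Matrix n) x s y r →
    (M · (λ c → x c + s * y c)) r ≈ (M · x) r + s * (M · y) r
  ·-combine {n} M x s y r = begin
    ∑[ c < n ] (M r c * (x c + s * y c))
      ≈⟨ sum-cong-≋ (λ c → distribute (M r c) (x c) s (y c)) ⟩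
    ∑[ c < n ] (M r c * x c + s * (M r c * y c))
      ≈⟨ ∑-distrib-+ (λ c → M r c * x c) (λ c → s * (M r c * y c)) ⟩
    (M · x) r + ∑[ c < n ] (s * (M r c * y c))
      ≈⟨ +-congˡ (*-distribˡ-sum s (λ c → M r c * y c)) ⟨
    (M · x) r + s * (M · y) r ∎
    where
    distribute : ∀ m x s y → m * (x + s * y) ≈ m * x + s * (m * y)
    distribute = solve 4 (λ m x s y → m :* (x :+ s :* y) := m :* x :+ s :* (m :* y)) ≈-refl

  e₀ : ∀ {n} → Vector Carrier n
  e₀ zero    = 1#
  e₀ (suc _) = 0#

  -- Only the term at `c` survives: every other minor contains the part of column `c` below the
  -- first row, which is zero.
  det-replace-e₀ : ∀ {n} (M : Matrix (suc n)) c →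
    determinant R (suc n) (replace M c e₀) ≈ (- 1#) ^ᴿ toℕ c * determinant R n (minor M c)
  det-replace-e₀ {n} M c = begin
    determinant R (suc n) N
      ≈⟨ sum-single c _ (λ j j≢c → ≈-trans (*-congˡ {(- 1#) ^ᴿ toℕ j * N zero j} (vanish j≢c)) (zeroʳ _)) ⟩
    s * N zero c * determinant R n (minor N c)
      ≈⟨ *-cong (≈-trans (*-congˡ {s} (reflexive (replace-at M c e₀ zero))) (*-identityʳ s))
                (det-cong n λ r k → reflexive (replace-off M c e₀ (suc r) (Finₚ.punchInᵢ≢i c k))) ⟩
    s * determinant R n (minor M c) ∎
    where
    N = replace M c e₀
    s = (- 1#) ^ᴿ toℕ c
    vanish : ∀ {j} → j ≢ c → determinant R n (minor N j) ≈ 0#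
    vanish {j} j≢c = det-zeroColumn n (punchOut j≢c) λ r → reflexive
      (trans (cong (N (suc r)) (Finₚ.punchIn-punchOut j≢c)) (replace-at M c e₀ (suc r)))

  cramer-e₀ : ∀ {n} (M : Matrix (suc n)) x → (∀ r → (M · x) r ≈ e₀ r) → ∀ c →
    x c * determinant R (suc n) M ≈ determinant R n (minor M c) * (- 1#) ^ᴿ toℕ c
  cramer-e₀ {n} M x Mx≈e₀ c = begin
    x c * determinant R (suc n) M                   ≈⟨ cramer M x c ⟨
    determinant R (suc n) (replace M c (M · x))
      ≈⟨ det-cong (suc n) (replace-cong {M = M} c Mx≈e₀ λ _ _ _ → ≈-refl) ⟩
    determinant R (suc n) (replace M c e₀)          ≈⟨ det-replace-e₀ M c ⟩
    (- 1#) ^ᴿ toℕ c * determinant R n (minor M c)    ≈⟨ *-comm _ _ ⟩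
    determinant R n (minor M c) * (- 1#) ^ᴿ toℕ c    ∎

-- Finite sets: the pigeonhole principle and decidable subsets

-- If `y` were missed, punching it out of the codomain would inject `Fin (suc n)` into `Fin n`.
Fin-injective⇒surjective : ∀ {n} (f : Fin n → Fin n) → Injective _≡_ _≡_ f → ∀ y → ∃[ x ] f x ≡ y
Fin-injective⇒surjective {suc n} f inj y with Finₚ.any? (λ x → f x Finₚ.≟ y)
... | yes hit = hit
... | no miss = ⊥-elim (ℕₚ.1+n≰n (Finₚ.injective⇒≤ {f = f-avoiding-y} (λ p → inj (Finₚ.punchOut-injective {i = y} _ _ p))))
  where
  f-avoiding-y : Fin (suc n) → Fin n
  f-avoiding-y x = punchOut {i = y} {j = f x} λ y≡fx → miss (x , sym y≡fx)

finite-injective⇒surjective : ∀ {A : Set} {N} → A ↔ Fin N → (f : A → A) →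
  Injective _≡_ _≡_ f → ∀ y → ∃[ x ] f x ≡ y
finite-injective⇒surjective A↔Fin f inj y =
  let i , eq = Fin-injective⇒surjective (to ∘ f ∘ from)
                  (λ p → Injection.injective (↔⇒↣ (↔-sym A↔Fin))
                           (inj (Injection.injective (↔⇒↣ A↔Fin) p)))
                  (to y)
  in from i , Injection.injective (↔⇒↣ A↔Fin) eq
  where open Inverse A↔Fin

tabulate-injective : ∀ {A : Set} {n} {f g : Fin n → A} → tabulate f ≡ tabulate g → ∀ i → f i ≡ g i
tabulate-injective {f = f} {g} eq i = begin
  f i                   ≡⟨ Vecₚ.lookup∘tabulate f i ⟨
  lookup (tabulate f) i ≡⟨ cong (λ v → lookup v i) eq ⟩
  lookup (tabulate g) i ≡⟨ Vecₚ.lookup∘tabulate g i ⟩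
  g i                   ∎
  where open ≡-Reasoning

lookup-extensional : ∀ {A : Set} {n} {v w : Vec A n} → (∀ i → lookup v i ≡ lookup w i) → v ≡ w
lookup-extensional {v = v} {w} eq =
  trans (sym (Vecₚ.tabulate∘lookup v)) (trans (Vecₚ.tabulate-cong eq) (Vecₚ.tabulate∘lookup w))

Vec-finite : ∀ {A : Set} {q} → A ↔ Fin q → ∀ n → Vec A n ↔ Fin (q ℕ.^ n)
Vec-finite A↔Fin zero    = mk↔ₛ′ (const zero) (const []) (λ { zero → refl }) (λ { [] → refl })
Vec-finite A↔Fin (suc n) =
  ↔-sym Finₚ.*↔× ↔-∘ ((A↔Fin ×-↔ Vec-finite A↔Fin n) ↔-∘ uncons)
  where
  uncons = mk↔ₛ′ (λ v → Vec.head v , Vec.tail v) (λ (x , xs) → x ∷ xs)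
                 (λ _ → refl) (λ { (_ ∷ _) → refl })

-- Equality looks only at the elements, so proofs of `P`, here families of inequalities, never have
-- to be compared.
Subtype : (A : Set) → (A → Set) → Setoid 0ℓ 0ℓ
Subtype A P = On.setoid {B = Σ[ x ∈ A ] P x} (≡.setoid A) proj₁

Fin-subtype-finite : ∀ {N} {P : Fin N → Set} → Decidable P → ∃[ L ] HasCardinality (Subtype (Fin N) P) L
Fin-subtype-finite {zero}  P? = 0 , record
  { to = λ () ; from = λ () ; to-cong = λ { {()} } ; from-cong = λ { {()} }
  ; inverse = (λ { {()} }) , (λ { {()} }) }
Fin-subtype-finite {suc N} {P} P? with Fin-subtype-finite (P? ∘ suc) | P? zero
... | L , rest | yes p₀ = suc L , record
  { to = to ; from = from
  ; to-cong = λ {x} {y} → to-cong {x} {y} ; from-cong = λ { refl → refl }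
  ; inverse = (λ {x} {y} → inverseˡ {x} {y}) , (λ {x} → inverseʳ {x}) }
  where
  module S = Inverse rest
  to : Σ[ i ∈ Fin (suc N) ] P i → Fin (suc L)
  to (zero  , _) = zero
  to (suc i , p) = suc (S.to (i , p))
  from : Fin (suc L) → Σ[ i ∈ Fin (suc N) ] P i
  from zero    = zero , p₀
  from (suc j) = suc (proj₁ (S.from j)) , proj₂ (S.from j)
  to-cong : ∀ {x y} → proj₁ x ≡ proj₁ y → to x ≡ to y
  to-cong {zero  , _} {zero  , _} _  = refl
  to-cong {suc i , _} {suc j , _} eq = cong suc (S.to-cong (Finₚ.suc-injective eq))
  inverseˡ : ∀ {j x} → proj₁ x ≡ proj₁ (from j) → to x ≡ j
  inverseˡ {zero}  {zero  , _} _  = refl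
  inverseˡ {suc j} {suc i , _} eq = cong suc (S.inverseˡ (Finₚ.suc-injective eq))
  inverseʳ : ∀ {x j} → j ≡ to x → proj₁ (from j) ≡ proj₁ x
  inverseʳ {zero  , _} refl = refl
  inverseʳ {suc i , p} refl = cong suc (S.inverseʳ refl)
... | L , rest | no ¬p₀ = L , record
  { to = to ; from = from
  ; to-cong = λ {x} {y} → to-cong {x} {y} ; from-cong = λ { refl → refl }
  ; inverse = (λ {x} {y} → inverseˡ {x} {y}) , (λ {x} → inverseʳ {x}) }
  where
  module S = Inverse rest
  to : Σ[ i ∈ Fin (suc N) ] P i → Fin L
  to (zero  , p) = ⊥-elim (¬p₀ p)
  to (suc i , p) = S.to (i , p)
  from : Fin L → Σ[ i ∈ Fin (suc N) ] P i
  from j = suc (proj₁ (S.from j)) , proj₂ (S.from j)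
  to-cong : ∀ {x y} → proj₁ x ≡ proj₁ y → to x ≡ to y
  to-cong {zero  , p} {_}         _  = ⊥-elim (¬p₀ p)
  to-cong {suc i , _} {suc j , _} eq = S.to-cong (Finₚ.suc-injective eq)
  inverseˡ : ∀ {j x} → proj₁ x ≡ proj₁ (from j) → to x ≡ j
  inverseˡ {j} {suc i , _} eq = S.inverseˡ (Finₚ.suc-injective eq)
  inverseʳ : ∀ {x j} → j ≡ to x → proj₁ (from j) ≡ proj₁ x
  inverseʳ {zero  , p} _    = ⊥-elim (¬p₀ p)
  inverseʳ {suc i , p} refl = cong suc (S.inverseʳ refl)

mkInverse : ∀ {S T : Setoid 0ℓ 0ℓ} → let module S = Setoid S ; module T = Setoid T in
  (to : S.Carrier → T.Carrier) (from : T.Carrier → S.Carrier) →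
  (∀ {x y} → x S.≈ y → to x T.≈ to y) → (∀ {x y} → x T.≈ y → from x S.≈ from y) →
  (∀ y → to (from y) T.≈ y) → (∀ x → from (to x) S.≈ x) → Inverse S T
mkInverse {S} {T} to from to-cong from-cong to∘from from∘to = record
  { to = to ; from = from ; to-cong = to-cong ; from-cong = from-cong
  ; inverse = (λ x≈ → T.trans (to-cong x≈) (to∘from _)) , (λ y≈ → S.trans (from-cong y≈) (from∘to _)) }
  where
  module S = Setoid S
  module T = Setoid T

subtype-finite : ∀ {A : Set} {N} {P : A → Set} → A ↔ Fin N → Decidable P →
  ∃[ L ] HasCardinality (Subtype A P) L
subtype-finite {A} {N} {P} A↔Fin P? = L , mkInverse
    (λ (x , p) → C.to (to x , ≡.subst P (sym (strictlyInverseʳ x)) p))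
    (λ j → from (proj₁ (C.from j)) , proj₂ (C.from j))
    (λ x≡y → C.to-cong (cong to x≡y))
    (λ j≡k → cong from (C.from-cong j≡k))
    (λ j → C.inverseˡ (strictlyInverseˡ _))
    (λ x → trans (cong from (C.inverseʳ refl)) (strictlyInverseʳ _))
  where
  open Inverse A↔Fin
  L = proj₁ (Fin-subtype-finite (P? ∘ from))
  module C = Inverse (proj₂ (Fin-subtype-finite (P? ∘ from)))

-- Nonsingular matrices over a finite field

module Nonsingular {q} (𝔽 : FiniteField q) where
  open FiniteField 𝔽
  open CommutativeRing commutativeRing
    using (ring; semiring; +-identityˡ; +-identityʳ; *-identityʳ; *-assoc; zeroˡ; zeroʳ; -‿inverseʳ)
  open RingProperties ring using (-1*x≈-x; x∙y⁻¹≈ε⇒x≈y; -‿involutive)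
  open ColumnOperations commutativeRing
  open SemiringExp semiring using () renaming (_^_ to _^ᴿ_)
  open SemiringSum semiring
  open ≡-Reasoning

  infix 4 _≟_

  _≟_ : DecidableEquality Carrier
  _≟_ = via-injection (↔⇒↣ finite) Finₚ._≟_

  x≢0∧y*x≡0⇒y≡0 : ∀ {x y} → x ≢ 0# → y * x ≡ 0# → y ≡ 0#
  x≢0∧y*x≡0⇒y≡0 {x} {y} x≢0 yx≡0 with z , xz≡1 ← inverse x x≢0 = begin
    y           ≡⟨ *-identityʳ y ⟨
    y * 1#      ≡⟨ cong (y *_) xz≡1 ⟨
    y * (x * z) ≡⟨ *-assoc y x z ⟨
    y * x * z   ≡⟨ cong (_* z) yx≡0 ⟩
    0# * z      ≡⟨ zeroˡ z ⟩
    0#          ∎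

  -- Differences have this shape because they arise as the case `s = - 1#` of the combinations
  -- `x + s * y` in `·-combine` and `convolve-combine`.
  x+-1*y≡0⇒x≡y : ∀ {x y} → x + - 1# * y ≡ 0# → x ≡ y
  x+-1*y≡0⇒x≡y {x} {y} eq = x∙y⁻¹≈ε⇒x≈y x y (trans (cong (x +_) (sym (-1*x≈-x y))) eq)

  x+-1*x≡0 : ∀ x → x + - 1# * x ≡ 0#
  x+-1*x≡0 x = trans (cong (x +_) (-1*x≈-x x)) (-‿inverseʳ x)

  -1^n≢0 : ∀ n → (- 1#) ^ᴿ n ≢ 0#
  -1^n≢0 zero    eq = 0#≢1# (sym eq)
  -1^n≢0 (suc n) eq = -1^n≢0 n (begin
    (- 1#) ^ᴿ n     ≡⟨ -‿involutive _ ⟨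
    - (- ((- 1#) ^ᴿ n)) ≡⟨ cong -_ (trans (sym (-1*x≈-x _)) eq) ⟩
    - 0#           ≡⟨ +-identityˡ _ ⟨
    0# + - 0#      ≡⟨ -‿inverseʳ 0# ⟩
    0#             ∎)

  TrivialKernel : ∀ {n} → Matrix n → Set
  TrivialKernel M = ∀ x → (∀ r → (M · x) r ≡ 0#) → ∀ c → x c ≡ 0#

  det≢0⇒trivialKernel : ∀ {n} {M : Matrix n} → determinant commutativeRing n M ≢ 0# → TrivialKernel M
  det≢0⇒trivialKernel {n} {M} det≢0 x Mx≡0 c = x≢0∧y*x≡0⇒y≡0 det≢0 (begin
    x c * determinant commutativeRing n M              ≡⟨ cramer M x c ⟨
    determinant commutativeRing n (replace M c (M · x))
      ≡⟨ det-zeroColumn n c (λ r → trans (replace-at M c (M · x) r) (Mx≡0 r)) ⟩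
    0#                                                 ∎)

  -- Finiteness of the field stands in for elimination: `M` acts on a finite set of vectors,
  -- injectively because differences of vectors with equal images lie in the kernel, hence
  -- surjectively.
  trivialKernel⇒surjective : ∀ {n} {M : Matrix n} → TrivialKernel M →
    ∀ y → ∃[ x ] (∀ r → (M · x) r ≡ y r)
  trivialKernel⇒surjective {n} {M} ker y =
    let v , eq = finite-injective⇒surjective (Vec-finite finite n) f f-injective (tabulate y)
    in lookup v , λ r → begin
        (M · lookup v) r       ≡⟨ Vecₚ.lookup∘tabulate (M · lookup v) r ⟨
        lookup (f v) r         ≡⟨ cong (λ w → lookup w r) eq ⟩
        lookup (tabulate y) r  ≡⟨ Vecₚ.lookup∘tabulate y r ⟩
        y r                    ∎
    where
    f : Vec Carrier n → Vec Carrier n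
    f v = tabulate (M · lookup v)
    f-injective : Injective _≡_ _≡_ f
    f-injective {v} {w} fv≡fw = begin
      v                   ≡⟨ Vecₚ.tabulate∘lookup v ⟨
      tabulate (lookup v) ≡⟨ Vecₚ.tabulate-cong (λ c → x+-1*y≡0⇒x≡y (ker _ difference c)) ⟩
      tabulate (lookup w) ≡⟨ Vecₚ.tabulate∘lookup w ⟩
      w                   ∎
      where
      difference : ∀ r → (M · (λ c → lookup v c + - 1# * lookup w c)) r ≡ 0#
      difference r = begin
        (M · (λ c → lookup v c + - 1# * lookup w c)) r
          ≡⟨ ·-combine M (lookup v) (- 1#) (lookup w) r ⟩
        (M · lookup v) r + - 1# * (M · lookup w) r
          ≡⟨ cong (λ z → z + - 1# * (M · lookup w) r) (tabulate-injective fv≡fw r) ⟩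
        (M · lookup w) r + - 1# * (M · lookup w) r     ≡⟨ x+-1*x≡0 _ ⟩
        0#                                             ∎

  -- If M x = e₀ and the minor at c kills y, then M maps y extended by 0 at c to
  -- a multiple t e₀, so the extension is t x and its entry at c forces t = 0.

  minor-trivialKernel : ∀ {n} {M : Matrix (suc n)} {x} → TrivialKernel M →
    (∀ r → (M · x) r ≡ e₀ r) → ∀ {c} → x c ≢ 0# → TrivialKernel (minor M c)
  minor-trivialKernel {n} {M} {x} ker Mx≡e₀ {c} xc≢0 y minor-y≡0 j = begin
    y j                            ≡⟨ insertAt-punchIn y c 0# j ⟨
    y′ (punchIn c j)               ≡⟨ +-identityʳ _ ⟨
    y′ (punchIn c j) + 0#
      ≡⟨ cong (y′ (punchIn c j) +_) (trans (cong (_* x (punchIn c j)) -t≡0) (zeroˡ _)) ⟨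
    y′ (punchIn c j) + - t * x (punchIn c j) ≡⟨ ker z Mz≡0 (punchIn c j) ⟩
    0#                             ∎
    where
    y′ : Vector Carrier (suc n)
    y′ = insertAt y c 0#
    t : Carrier
    t = (M · y′) zero
    z : Vector Carrier (suc n)
    z k = y′ k + - t * x k
    My′≡0 : ∀ r → (M · y′) (suc r) ≡ 0#
    My′≡0 r = begin
      (M · y′) (suc r)
        ≡⟨ sum-remove {i = c} (λ k → M (suc r) k * y′ k) ⟩
      M (suc r) c * y′ c + ∑[ k < n ] (M (suc r) (punchIn c k) * y′ (punchIn c k))
        ≡⟨ cong₂ _+_ (trans (cong (M (suc r) c *_) (insertAt-lookup y c 0#)) (zeroʳ _))
             (trans (sum-cong-≗ (λ k → cong (M (suc r) (punchIn c k) *_) (insertAt-punchIn y c 0# k))) (minor-y≡0 r)) ⟩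
      0# + 0# ≡⟨ +-identityˡ 0# ⟩
      0# ∎
    Mz≡0 : ∀ r → (M · z) r ≡ 0#
    Mz≡0 zero = begin
      (M · z) zero               ≡⟨ ·-combine M y′ (- t) x zero ⟩
      t + - t * (M · x) zero     ≡⟨ cong (λ w → t + - t * w) (Mx≡e₀ zero) ⟩
      t + - t * 1#               ≡⟨ cong (t +_) (*-identityʳ (- t)) ⟩
      t + - t                    ≡⟨ -‿inverseʳ t ⟩
      0#                         ∎
    Mz≡0 (suc r) = begin
      (M · z) (suc r)                       ≡⟨ ·-combine M y′ (- t) x (suc r) ⟩
      (M · y′) (suc r) + - t * (M · x) (suc r)
        ≡⟨ cong₂ (λ v w → v + - t * w) (My′≡0 r) (Mx≡e₀ (suc r)) ⟩
      0# + - t * 0#                         ≡⟨ trans (+-identityˡ _) (zeroʳ (- t)) ⟩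
      0#                                    ∎
    -t≡0 : - t ≡ 0#
    -t≡0 = x≢0∧y*x≡0⇒y≡0 xc≢0 (begin
      - t * x c        ≡⟨ +-identityˡ _ ⟨
      0# + - t * x c   ≡⟨ cong (_+ - t * x c) (insertAt-lookup y c 0#) ⟨
      y′ c + - t * x c ≡⟨ ker z Mz≡0 c ⟩
      0#               ∎)

  -- If all entries of `x` were zero, row 0 would give `0# ≡ 1#`. Decidable equality on the carrier
  -- turns this into an explicit index `c`.
  M·x≡e₀⇒x≢0 : ∀ {n} (M : Matrix (suc n)) {x} → (∀ r → (M · x) r ≡ e₀ r) → ∃[ c ] x c ≢ 0#
  M·x≡e₀⇒x≢0 {n} M {x} Mx≡e₀ = Finₚ.¬∀⟶∃¬ (suc n) _ (λ c → x c ≟ 0#) λ x≡0 → 0#≢1# (begin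
    0#
      ≡⟨ sum-zero (λ c → M zero c * x c) (λ c → trans (cong (M zero c *_) (x≡0 c)) (zeroʳ _)) ⟨
    (M · x) zero ≡⟨ Mx≡e₀ zero ⟩
    1#           ∎)

  -- By `cramer-e₀` the determinant of the minor is, up to sign, `x c` times that of `M`.
  minor-det≢0⇒det≢0 : ∀ {n} (M : Matrix (suc n)) x → (∀ r → (M · x) r ≡ e₀ r) → ∀ c →
    determinant commutativeRing n (minor M c) ≢ 0# → determinant commutativeRing (suc n) M ≢ 0#
  minor-det≢0⇒det≢0 {n} M x Mx≡e₀ c minor≢0 det≡0 =
    minor≢0 (x≢0∧y*x≡0⇒y≡0 {(- 1#) ^ᴿ toℕ c} {determinant commutativeRing n (minor M c)} (-1^n≢0 (toℕ c)) (begin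
      determinant commutativeRing n (minor M c) * (- 1#) ^ᴿ toℕ c ≡⟨ cramer-e₀ M x Mx≡e₀ c ⟨
      x c * determinant commutativeRing (suc n) M                ≡⟨ cong (x c *_) det≡0 ⟩
      x c * 0#                                                   ≡⟨ zeroʳ (x c) ⟩
      0#                                                         ∎))

  -- Induction on the size. The column `c` is chosen with `x c ≢ 0#` so that the minor inherits the
  -- trivial kernel; the way back from the determinant of the minor works for any column.
  trivialKernel⇒det≢0 : ∀ n {M : Matrix n} → TrivialKernel M → determinant commutativeRing n M ≢ 0#
  trivialKernel⇒det≢0 zero    ker det≡0 = 0#≢1# (sym det≡0)
  trivialKernel⇒det≢0 (suc n) {M} ker = pivot (trivialKernel⇒surjective {M = M} ker e₀)
    where
    pivot : ∃[ x ] (∀ r → (M · x) r ≡ e₀ r) → determinant commutativeRing (suc n) M ≢ 0#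
    pivot (x , Mx≡e₀) = expand (M·x≡e₀⇒x≢0 M Mx≡e₀)
      where
      expand : ∃[ c ] x c ≢ 0# → determinant commutativeRing (suc n) M ≢ 0#
      expand (c , xc≢0) = minor-det≢0⇒det≢0 M x Mx≡e₀ c
        (trivialKernel⇒det≢0 n {minor M c} (minor-trivialKernel {M = M} {x} ker Mx≡e₀ {c} xc≢0))

-- Words read at natural-number positions

module Entries {A : Set} (default : A) where

  -- Reading is total, with `default` beyond the end. Inputs, coefficients, windows and fused words
  -- of different lengths can then be compared by arithmetic on positions, without casts between
  -- `Fin` types.
  nth : List A → ℕ → A
  nth List.[]       _       = default
  nth (x List.∷ _)  zero    = x
  nth (_ List.∷ xs) (suc t) = nth xs t

  nth-++ˡ : ∀ xs {ys t} → t < List.length xs → nth (xs List.++ ys) t ≡ nth xs t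
  nth-++ˡ (x List.∷ xs) {t = zero}  _         = refl
  nth-++ˡ (x List.∷ xs) {t = suc t} (s≤s t<n) = nth-++ˡ xs t<n

  nth-++ʳ : ∀ xs {ys} t → nth (xs List.++ ys) (List.length xs ℕ.+ t) ≡ nth ys t
  nth-++ʳ List.[]       t = refl
  nth-++ʳ (x List.∷ xs) t = nth-++ʳ xs t

  nth-extensional : ∀ xs ys → List.length xs ≡ List.length ys →
    (∀ {t} → t < List.length xs → nth xs t ≡ nth ys t) → xs ≡ ys
  nth-extensional List.[]       List.[]       _  _  = refl
  nth-extensional (x List.∷ xs) (y List.∷ ys) eq nth≡ =
    cong₂ List._∷_ (nth≡ (s≤s z≤n)) (nth-extensional xs ys (ℕₚ.suc-injective eq) (nth≡ ∘ s≤s))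

  at : ∀ {n} → Vec A n → ℕ → A
  at v = nth (toList v)

  at-toℕ : ∀ {n} (v : Vec A n) i → at v (toℕ i) ≡ lookup v i
  at-toℕ (x ∷ v) zero    = refl
  at-toℕ (x ∷ v) (suc i) = at-toℕ v i

  at-fromℕ< : ∀ {n} (v : Vec A n) {t} (t<n : t < n) → lookup v (fromℕ< t<n) ≡ at v t
  at-fromℕ< v t<n = trans (sym (at-toℕ v (fromℕ< t<n))) (cong (at v) (Finₚ.toℕ-fromℕ< t<n))

  at-beyond : ∀ {n} (v : Vec A n) {t} → n ≤ t → at v t ≡ default
  at-beyond []      _         = refl
  at-beyond (x ∷ v) (s≤s n≤t) = at-beyond v n≤t

  at-tabulate : ∀ {n} (g : ℕ → A) {t} → t < n → at (tabulate {n = n} (g ∘ toℕ)) t ≡ g t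
  at-tabulate {n} g {t} t<n = begin
    at v t                  ≡⟨ at-fromℕ< v t<n ⟨
    lookup v (fromℕ< t<n)   ≡⟨ Vecₚ.lookup∘tabulate _ (fromℕ< t<n) ⟩
    g (toℕ (fromℕ< t<n))    ≡⟨ cong g (Finₚ.toℕ-fromℕ< t<n) ⟩
    g t                     ∎
    where
    open ≡-Reasoning
    v = tabulate {n = n} (g ∘ toℕ)

  at-extensional : ∀ {n} {v w : Vec A n} → (∀ {t} → t < n → at v t ≡ at w t) → v ≡ w
  at-extensional {v = []}    {[]}    eq = refl
  at-extensional {v = x ∷ v} {y ∷ w} eq = cong₂ _∷_ (eq (s≤s z≤n)) (at-extensional (eq ∘ s≤s))

  at-replicate : ∀ n t → at (replicate n default) t ≡ default
  at-replicate zero    t       = refl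
  at-replicate (suc n) zero    = refl
  at-replicate (suc n) (suc t) = at-replicate n t

  at-++ˡ : ∀ {m n} (v : Vec A m) (w : Vec A n) {t} → t < m → at (v Vec.++ w) t ≡ at v t
  at-++ˡ (x ∷ v) w {zero}  _         = refl
  at-++ˡ (x ∷ v) w {suc t} (s≤s t<m) = at-++ˡ v w t<m

  at-++ʳ : ∀ {m n} (v : Vec A m) (w : Vec A n) t → at (v Vec.++ w) (m ℕ.+ t) ≡ at w t
  at-++ʳ []      w t = refl
  at-++ʳ (x ∷ v) w t = at-++ʳ v w t

  at-∷ʳ : ∀ {n} (v : Vec A n) x {t} → t < n → at (v ∷ʳ x) t ≡ at v t
  at-∷ʳ (y ∷ v) x {zero}  _         = refl
  at-∷ʳ (y ∷ v) x {suc t} (s≤s t<n) = at-∷ʳ v x t<n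

  at-∷ʳ-last : ∀ {n} (v : Vec A n) x → at (v ∷ʳ x) n ≡ x
  at-∷ʳ-last []      x = refl
  at-∷ʳ-last (y ∷ v) x = at-∷ʳ-last v x

  at-concat-update : ∀ {k b} (vs : Vec (Vec A b) k) j y {t} → t < b →
    at (concat (vs [ j ]≔ y)) (toℕ j ℕ.* b ℕ.+ t) ≡ at y t
  at-concat-update (v ∷ vs) zero y t<b = at-++ˡ y (concat vs) t<b
  at-concat-update {b = b} (v ∷ vs) (suc j) y {t} t<b = begin
    at (v Vec.++ concat (vs [ j ]≔ y)) (b ℕ.+ toℕ j ℕ.* b ℕ.+ t)
      ≡⟨ cong (at (v Vec.++ concat (vs [ j ]≔ y))) (ℕₚ.+-assoc b _ t) ⟩
    at (v Vec.++ concat (vs [ j ]≔ y)) (b ℕ.+ (toℕ j ℕ.* b ℕ.+ t))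
      ≡⟨ at-++ʳ v _ _ ⟩
    at (concat (vs [ j ]≔ y)) (toℕ j ℕ.* b ℕ.+ t)
      ≡⟨ at-concat-update vs j y t<b ⟩
    at y t ∎
    where open ≡-Reasoning

  at-concat-fixed : ∀ {k b} (vs : Vec (Vec A b) k) j y z {t} →
    t < toℕ j ℕ.* b ⊎ toℕ j ℕ.* b ℕ.+ b ≤ t →
    at (concat (vs [ j ]≔ y)) t ≡ at (concat (vs [ j ]≔ z)) t
  at-concat-fixed {b = b} (v ∷ vs) zero y z {t} (inj₂ b≤t) = begin
    at (y Vec.++ concat vs) t               ≡⟨ cong (at (y Vec.++ concat vs)) (ℕₚ.m+[n∸m]≡n b≤t) ⟨
    at (y Vec.++ concat vs) (b ℕ.+ (t ∸ b)) ≡⟨ at-++ʳ y (concat vs) (t ∸ b) ⟩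
    at (concat vs) (t ∸ b)                  ≡⟨ at-++ʳ z (concat vs) (t ∸ b) ⟨
    at (z Vec.++ concat vs) (b ℕ.+ (t ∸ b)) ≡⟨ cong (at (z Vec.++ concat vs)) (ℕₚ.m+[n∸m]≡n b≤t) ⟩
    at (z Vec.++ concat vs) t               ∎
    where open ≡-Reasoning
  at-concat-fixed {b = b} (v ∷ vs) (suc j) y z {t} outside with ℕₚ.<-≤-connex t b
  ... | inj₁ t<b = trans (at-++ˡ v _ t<b) (sym (at-++ˡ v _ t<b))
  ... | inj₂ b≤t = begin
    at (v Vec.++ Y) t               ≡⟨ cong (at (v Vec.++ Y)) b+s≡t ⟨
    at (v Vec.++ Y) (b ℕ.+ (t ∸ b)) ≡⟨ at-++ʳ v Y (t ∸ b) ⟩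
    at Y (t ∸ b)                    ≡⟨ at-concat-fixed vs j y z (shift outside) ⟩
    at Z (t ∸ b)                    ≡⟨ at-++ʳ v Z (t ∸ b) ⟨
    at (v Vec.++ Z) (b ℕ.+ (t ∸ b)) ≡⟨ cong (at (v Vec.++ Z)) b+s≡t ⟩
    at (v Vec.++ Z) t               ∎
    where
    open ≡-Reasoning
    Y = concat (vs [ j ]≔ y)
    Z = concat (vs [ j ]≔ z)
    b+s≡t = ℕₚ.m+[n∸m]≡n b≤t
    shift : t < b ℕ.+ toℕ j ℕ.* b ⊎ b ℕ.+ toℕ j ℕ.* b ℕ.+ b ≤ t →
            t ∸ b < toℕ j ℕ.* b ⊎ toℕ j ℕ.* b ℕ.+ b ≤ t ∸ b
    shift (inj₁ t<) = inj₁ (ℕₚ.+-cancelˡ-< b _ _ (ℕₚ.≤-trans (s≤s (ℕₚ.≤-reflexive b+s≡t)) t<))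
    shift (inj₂ ≤t) = inj₂ (ℕₚ.+-cancelˡ-≤ b _ _ (ℕₚ.≤-trans
      (ℕₚ.≤-reflexive (sym (ℕₚ.+-assoc b _ b))) (ℕₚ.≤-trans ≤t (ℕₚ.≤-reflexive (sym b+s≡t)))))

-- Locates `t` relative to the interval of length `n` starting at `p`, typically a block. Matching
-- the equation in `inside` replaces `t` by `p + s`.
data Position (p n t : ℕ) : Set where
  before : t < p → Position p n t
  inside : ∀ s → s < n → t ≡ p ℕ.+ s → Position p n t
  after  : p ℕ.+ n ≤ t → Position p n t

position : ∀ p n t → Position p n t
position p n t with ℕₚ.<-≤-connex t p
... | inj₁ t<p = before t<p
... | inj₂ p≤t with ℕₚ.<-≤-connex t (p ℕ.+ n)
...   | inj₂ ≤t = after ≤t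
...   | inj₁ t< = inside (t ∸ p) (ℕₚ.+-cancelˡ-< p _ _ (ℕₚ.≤-trans (s≤s (ℕₚ.≤-reflexive eq)) t<)) (sym eq)
  where eq = ℕₚ.m+[n∸m]≡n p≤t

-- The automaton as a banded Toeplitz matrix, and its blocks

module Automata {q} (𝔽 : FiniteField q) where
  open FiniteField 𝔽
  open CommutativeRing commutativeRing
    using (semiring; +-identityˡ; +-identityʳ; *-identityˡ; *-identityʳ; zeroʳ; commutativeSemiring)
  open SemiringSum semiring
  open ColumnOperations commutativeRing using (sum-zero; sum-single; _·_)
  open Nonsingular 𝔽
  open Entries 0# public
  open RingSolver commutativeSemiring using (solve; _:+_; _:*_; _:=_)
  open ≡-Reasoning

  sum-restrict : ∀ p n N (g : ℕ → Carrier) → p ℕ.+ n ≤ N →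
    (∀ t → t < p ⊎ p ℕ.+ n ≤ t → g t ≡ 0#) →
    ∑[ j < N ] g (toℕ j) ≡ ∑[ c < n ] g (p ℕ.+ toℕ c)
  sum-restrict zero    zero    N       g _         g≡0 = sum-zero (λ j → g (toℕ {N} j)) (λ j → g≡0 _ (inj₂ z≤n))
  sum-restrict zero    (suc n) (suc N) g (s≤s n≤N) g≡0 =
    cong (g 0 +_) (sum-restrict zero n N (g ∘ suc) n≤N λ { t (inj₂ n≤t) → g≡0 (suc t) (inj₂ (s≤s n≤t)) })
  sum-restrict (suc p) n       (suc N) g (s≤s p+n≤N) g≡0 = begin
    g 0 + ∑[ j < N ] g (suc (toℕ j))         ≡⟨ cong₂ _+_ (g≡0 0 (inj₁ (s≤s z≤n)))
      (sum-restrict p n N (g ∘ suc) p+n≤N λ { t (inj₁ t<p) → g≡0 (suc t) (inj₁ (s≤s t<p))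
                                             ; t (inj₂ ≤t)  → g≡0 (suc t) (inj₂ (s≤s ≤t)) }) ⟩
    0# + ∑[ c < n ] g (suc p ℕ.+ toℕ c)      ≡⟨ +-identityˡ _ ⟩
    ∑[ c < n ] g (suc p ℕ.+ toℕ c)           ∎

  coefficient : ∀ {e} → Vec Carrier e → ℕ → Carrier
  coefficient a = at (1# ∷ (a ∷ʳ 1#))

  -- Row `i` of the banded matrix applied to a word on all of ℕ. A vector supported on one block
  -- thus keeps its original positions.
  convolve : ∀ {e} → Vec Carrier e → (ℕ → Carrier) → ℕ → Carrier
  convolve {e} a X i = ∑[ j < 2 ℕ.+ e ] (coefficient a (toℕ j) * X (i ℕ.+ toℕ j))

  convolve-cong : ∀ {e} (a : Vec Carrier e) {X Y} → (∀ t → X t ≡ Y t) → ∀ i → convolve a X i ≡ convolve a Y i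
  convolve-cong {e} a X≡Y i = sum-cong-≗ {2 ℕ.+ e} λ j → cong (coefficient a (toℕ j) *_) (X≡Y (i ℕ.+ toℕ j))

  convolve-combine : ∀ {e} (a : Vec Carrier e) X s Y i →
    convolve a (λ t → X t + s * Y t) i ≡ convolve a X i + s * convolve a Y i
  convolve-combine {e} a X s Y i = begin
    ∑[ j < 2 ℕ.+ e ] (C j * (x j + s * y j))
      ≡⟨ sum-cong-≗ (λ j → solve 4 (λ c x s y → c :* (x :+ s :* y) := c :* x :+ s :* (c :* y)) refl (C j) (x j) s (y j)) ⟩
    ∑[ j < 2 ℕ.+ e ] (C j * x j + s * (C j * y j))
      ≡⟨ ∑-distrib-+ (λ j → C j * x j) (λ j → s * (C j * y j)) ⟩
    convolve a X i + ∑[ j < 2 ℕ.+ e ] (s * (C j * y j))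
      ≡⟨ cong (convolve a X i +_) (*-distribˡ-sum s (λ j → C j * y j)) ⟨
    convolve a X i + s * convolve a Y i ∎
    where
    C x y : Fin (2 ℕ.+ e) → Carrier
    C j = coefficient a (toℕ j)
    x j = X (i ℕ.+ toℕ j)
    y j = Y (i ℕ.+ toℕ j)

  CA-convolve : ∀ {m e n} (eq : m ℕ.+ (2 ℕ.+ e) ≡ suc n) (a : Vec Carrier e) x (i : Fin m) →
    lookup (cellularAutomaton eq (bipermutiveRule 𝔽 a) x) i ≡ convolve a (at x) (toℕ i)
  CA-convolve {e = e} eq a x i = begin
    lookup (cellularAutomaton eq (bipermutiveRule 𝔽 a) x) i
      ≡⟨ Vecₚ.lookup∘tabulate _ i ⟩
    ∑[ j < 2 ℕ.+ e ] (lookup γ j * lookup (tabulate X) j)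
      ≡⟨ sum-cong-≗ (λ j → cong₂ _*_ (sym (at-toℕ γ j)) (trans (Vecₚ.lookup∘tabulate X j) (at-fromℕ< x (window-bound eq i j)))) ⟩
    convolve a (at x) (toℕ i) ∎
    where
    γ = 1# ∷ (a ∷ʳ 1#)
    X : Fin (2 ℕ.+ e) → Carrier
    X j = lookup x (fromℕ< (window-bound eq i j))

  unit : ℕ → ℕ → Carrier
  unit s t with s ℕₚ.≟ t
  ... | yes _ = 1#
  ... | no  _ = 0#

  unit-diagonal : ∀ s → unit s s ≡ 1#
  unit-diagonal s with s ℕₚ.≟ s
  ... | yes _   = refl
  ... | no  s≢s = ⊥-elim (s≢s refl)

  unit-off : ∀ {s t} → s ≢ t → unit s t ≡ 0#
  unit-off {s} {t} s≢t with s ℕₚ.≟ t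
  ... | yes s≡t = ⊥-elim (s≢t s≡t)
  ... | no  _   = refl

  -- Row 0 applied to a unit word reads off a single coefficient; the position is `suc s` because
  -- position 0 holds the fixed leading `1#`.
  convolve-unit : ∀ {e n} (a : Vec Carrier e) → 2 ℕ.+ e ≤ n → ∀ {s} → s < e →
    convolve a (at (tabulate {n = n} (unit (suc s) ∘ toℕ))) 0 ≡ at a s
  convolve-unit {e} {n} a 2+e≤n {s} s<e = begin
    ∑[ j < 2 ℕ.+ e ] (coefficient a (toℕ j) * X (toℕ j))
      ≡⟨ sum-single c _ (λ j j≢c → trans (cong (coefficient a (toℕ j) *_)
           (trans (X≡unit j) (unit-off λ eq → j≢c (Finₚ.toℕ-injective (trans (sym eq) (sym toℕ-c)))))) (zeroʳ _)) ⟩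
    coefficient a (toℕ c) * X (toℕ c)
      ≡⟨ cong (coefficient a (toℕ c) *_) (trans (X≡unit c) (trans (cong (unit (suc s)) toℕ-c) (unit-diagonal (suc s)))) ⟩
    coefficient a (toℕ c) * 1#
      ≡⟨ *-identityʳ _ ⟩
    coefficient a (toℕ c)
      ≡⟨ cong (coefficient a) toℕ-c ⟩
    at (a ∷ʳ 1#) s
      ≡⟨ at-∷ʳ a 1# s<e ⟩
    at a s ∎
    where
    X = at (tabulate {n = n} (unit (suc s) ∘ toℕ))
    c : Fin (2 ℕ.+ e)
    c = suc (fromℕ< (ℕₚ.m<n⇒m<1+n s<e))
    toℕ-c : toℕ c ≡ suc s
    toℕ-c = cong suc (Finₚ.toℕ-fromℕ< (ℕₚ.m<n⇒m<1+n s<e))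
    X≡unit : ∀ (j : Fin (2 ℕ.+ e)) → X (toℕ j) ≡ unit (suc s) (toℕ j)
    X≡unit j = at-tabulate (unit (suc s)) (ℕₚ.<-≤-trans (Finₚ.toℕ<n j) 2+e≤n)

  -- The first output on unit words recovers every coefficient. So counting automata as maps amounts
  -- to counting coefficient words.
  CA-injective : ∀ {m e n} (eq : suc m ℕ.+ (2 ℕ.+ e) ≡ suc n) (a a′ : Vec Carrier e) →
    cellularAutomaton eq (bipermutiveRule 𝔽 a) ≗ cellularAutomaton eq (bipermutiveRule 𝔽 a′) → a ≡ a′
  CA-injective {m} {e} {n} eq a a′ CA≗ = at-extensional λ {s} s<e →
    let x = tabulate {n = n} (unit (suc s) ∘ toℕ) in begin
    at a s                      ≡⟨ convolve-unit a 2+e≤n s<e ⟨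
    convolve a (at x) 0         ≡⟨ CA-convolve eq a x zero ⟨
    lookup (cellularAutomaton eq (bipermutiveRule 𝔽 a) x) zero
      ≡⟨ cong (λ v → lookup v zero) (CA≗ x) ⟩
    lookup (cellularAutomaton eq (bipermutiveRule 𝔽 a′) x) zero ≡⟨ CA-convolve eq a′ x zero ⟩
    convolve a′ (at x) 0        ≡⟨ convolve-unit a′ 2+e≤n s<e ⟩
    at a′ s                     ∎
    where
    2+e≤n : 2 ℕ.+ e ≤ n
    2+e≤n = ℕₚ.≤-trans (ℕₚ.m≤n+m _ m) (ℕₚ.≤-reflexive (ℕₚ.suc-injective eq))

  -- Both sides are computed by `convolve`, in which the arity equation does not occur.
  CA-irrelevant : ∀ {m e e′ n} (p : e ≡ e′) (eq : m ℕ.+ (2 ℕ.+ e) ≡ suc n) (eq′ : m ℕ.+ (2 ℕ.+ e′) ≡ suc n) a →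
    cellularAutomaton eq (bipermutiveRule 𝔽 a) ≗ cellularAutomaton eq′ (bipermutiveRule 𝔽 (Vec.cast p a))
  CA-irrelevant refl eq eq′ a x = lookup-extensional λ i → begin
    lookup (cellularAutomaton eq (bipermutiveRule 𝔽 a) x) i ≡⟨ CA-convolve eq a x i ⟩
    convolve a (at x) (toℕ i)  ≡⟨ cong (λ a → convolve a (at x) (toℕ i)) (Vecₚ.cast-is-id refl a) ⟨
    convolve (Vec.cast refl a) (at x) (toℕ i) ≡⟨ CA-convolve eq′ (Vec.cast refl a) x i ⟨
    lookup (cellularAutomaton eq′ (bipermutiveRule 𝔽 (Vec.cast refl a)) x) i ∎

  -- The m-th block of b columns of the automaton has trivial kernel, whose elements
  -- are represented as words Z supported on the positions of that block.

  TrivialBlock : ∀ {e} → ℕ → Vec Carrier e → ℕ → Set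
  TrivialBlock b a m = ∀ Z →
    (∀ t → t < m ℕ.* b ⊎ m ℕ.* b ℕ.+ b ≤ t → Z t ≡ 0#) →
    (∀ i → i < b → convolve a Z i ≡ 0#) → ∀ t → Z t ≡ 0#

  -- Back substitution from the right end: the leading 1 of row `t` meets position `t`, and its
  -- other coefficients meet later positions, where `Z` already vanishes. The argument `s` of
  -- `vanish` bounds the distance from `t` up to `b`.
  firstBlock : ∀ {e} b (a : Vec Carrier e) → TrivialBlock b a 0
  firstBlock {e} b a Z outside conv≡0 t = vanish b t (ℕₚ.m≤n+m b t)
    where
    vanish : ∀ s t → b ≤ t ℕ.+ s → Z t ≡ 0#
    vanish zero    t b≤t = outside t (inj₂ (ℕₚ.≤-trans b≤t (ℕₚ.≤-reflexive (ℕₚ.+-identityʳ t))))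
    vanish (suc s) t b≤ with ℕₚ.<-≤-connex t b
    ... | inj₂ b≤t = outside t (inj₂ b≤t)
    ... | inj₁ t<b = begin
      Z t              ≡⟨ cong Z (ℕₚ.+-identityʳ t) ⟨
      Z (t ℕ.+ 0)      ≡⟨ *-identityˡ _ ⟨
      1# * Z (t ℕ.+ 0)
        ≡⟨ sum-single {n = 2 ℕ.+ e} zero (λ j → coefficient a (toℕ j) * Z (t ℕ.+ toℕ j)) rest ⟨
      convolve a Z t   ≡⟨ conv≡0 t t<b ⟩
      0#               ∎
      where
      rest : ∀ j → j ≢ zero → coefficient a (toℕ j) * Z (t ℕ.+ toℕ j) ≡ 0#
      rest zero    j≢0 = ⊥-elim (j≢0 refl)
      rest (suc j) _   = trans (cong (coefficient a (suc (toℕ j)) *_) (vanish s (t ℕ.+ suc (toℕ j)) bound)) (zeroʳ _)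
        where
        bound : b ≤ t ℕ.+ suc (toℕ j) ℕ.+ s
        bound = ℕₚ.≤-trans b≤ (ℕₚ.≤-trans (ℕₚ.+-monoʳ-≤ t (s≤s (ℕₚ.m≤n+m s (toℕ j))))
                  (ℕₚ.≤-reflexive (sym (ℕₚ.+-assoc t (suc (toℕ j)) s))))

  -- Forward substitution: the trailing 1 has index `suc e ≡ m * b`, so in row `s` it meets position
  -- `s` of block `m`, while the other coefficients meet earlier positions, where `Z` already
  -- vanishes.
  lastBlock : ∀ {e} b (a : Vec Carrier e) m → m ℕ.* b ≡ suc e → TrivialBlock b a m
  lastBlock {e} b a m m*b≡1+e Z outside conv≡0 t = vanish (suc t) t (ℕₚ.m≤n+m (suc t) _)
    where
    vanish : ∀ s t → t < m ℕ.* b ℕ.+ s → Z t ≡ 0#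
    vanish zero    t t< = outside t (inj₁ (ℕₚ.≤-trans t< (ℕₚ.≤-reflexive (ℕₚ.+-identityʳ _))))
    vanish (suc s) t t<
      with ℕₚ.m≤n⇒m<n∨m≡n (ℕₚ.≤-pred (ℕₚ.≤-trans t< (ℕₚ.≤-reflexive (ℕₚ.+-suc _ s))))
    ... | inj₁ t<′ = vanish s t t<′
    ... | inj₂ refl with ℕₚ.<-≤-connex s b
    ...   | inj₂ b≤s = outside t (inj₂ (ℕₚ.+-monoʳ-≤ (m ℕ.* b) b≤s))
    ...   | inj₁ s<b = begin
      Z (m ℕ.* b ℕ.+ s)         ≡⟨ cong Z position-last ⟨
      Z (s ℕ.+ toℕ l)           ≡⟨ *-identityˡ _ ⟨
      1# * Z (s ℕ.+ toℕ l)
        ≡⟨ cong (_* Z (s ℕ.+ toℕ l)) (trans (cong (coefficient a) (Finₚ.toℕ-fromℕ (suc e))) (at-∷ʳ-last a 1#)) ⟨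
      coefficient a (toℕ l) * Z (s ℕ.+ toℕ l)
        ≡⟨ sum-single l (λ j → coefficient a (toℕ j) * Z (s ℕ.+ toℕ j)) rest ⟨
      convolve a Z s            ≡⟨ conv≡0 s s<b ⟩
      0#                        ∎
      where
      l : Fin (2 ℕ.+ e)
      l = fromℕ (suc e)
      position-last : s ℕ.+ toℕ l ≡ m ℕ.* b ℕ.+ s
      position-last = trans (cong (s ℕ.+_) (trans (Finₚ.toℕ-fromℕ (suc e)) (sym m*b≡1+e))) (ℕₚ.+-comm s _)
      rest : ∀ j → j ≢ l → coefficient a (toℕ j) * Z (s ℕ.+ toℕ j) ≡ 0#
      rest j j≢l = trans (cong (coefficient a (toℕ j) *_) (vanish s (s ℕ.+ toℕ j) bound)) (zeroʳ _)
        where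
        toℕj<1+e : toℕ j < suc e
        toℕj<1+e = ℕₚ.≤∧≢⇒< (Finₚ.toℕ≤pred[n] j) λ eq →
          j≢l (Finₚ.toℕ-injective (trans eq (sym (Finₚ.toℕ-fromℕ (suc e)))))
        bound : s ℕ.+ toℕ j < m ℕ.* b ℕ.+ s
        bound = ℕₚ.<-≤-trans (ℕₚ.+-monoʳ-< s toℕj<1+e)
          (ℕₚ.≤-reflexive (trans (cong (s ℕ.+_) (sym m*b≡1+e)) (ℕₚ.+-comm s _)))

  window : ∀ {e} b → Vec Carrier e → ℕ → Vec Carrier (2 ℕ.* b ∸ 1)
  window b a μ = tabulate λ p → at a (μ ℕ.* b ℕ.+ toℕ p)

  at-window : ∀ {e} b (a : Vec Carrier e) μ {p} → p < 2 ℕ.* b ∸ 1 → at (window b a μ) p ≡ at a (μ ℕ.* b ℕ.+ p)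
  at-window b a μ p< = at-tabulate (λ p → at a (μ ℕ.* b ℕ.+ p)) p<

  -- Row i of the block μ + 1 meets the coefficients from position
  -- (μ + 1) b - i = μ b + (b - i) onwards.

  convolve-toeplitz : ∀ b′ {e} (a : Vec Carrier e) μ → let b = suc b′ in μ ℕ.* b ℕ.+ b ℕ.+ b′ ≤ e →
    ∀ Z → (∀ t → t < suc μ ℕ.* b ⊎ suc μ ℕ.* b ℕ.+ b ≤ t → Z t ≡ 0#) →
    ∀ r → convolve a Z (toℕ r) ≡ (toeplitz 𝔽 (window b a μ) · (λ c → Z (suc μ ℕ.* b ℕ.+ toℕ c))) r
  convolve-toeplitz b′ {e} a μ fits Z outside r = begin
    ∑[ j < 2 ℕ.+ e ] g (toℕ j)     ≡⟨ sum-restrict p b (2 ℕ.+ e) g p+b≤2+e g≡0 ⟩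
    ∑[ c < b ] g (p ℕ.+ toℕ c)
      ≡⟨ sum-cong-≗ (λ c → cong₂ _*_ (entry c) (cong Z (i+[p+x]≡start+x (toℕ c)))) ⟩
    (toeplitz 𝔽 (window b a μ) · (λ c → Z (suc μ ℕ.* b ℕ.+ toℕ c))) r ∎
    where
    b = suc b′
    i = toℕ r
    i≤b′ : i ≤ b′
    i≤b′ = Finₚ.toℕ≤pred[n] r
    start = suc μ ℕ.* b
    p = suc (μ ℕ.* b ℕ.+ (b′ ∸ i))
    g : ℕ → Carrier
    g t = coefficient a t * Z (i ℕ.+ t)

    i+p≡start : i ℕ.+ p ≡ start
    i+p≡start = begin
      i ℕ.+ suc (μ ℕ.* b ℕ.+ (b′ ∸ i)) ≡⟨ ℕₚ.+-suc i _ ⟩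
      suc (i ℕ.+ (μ ℕ.* b ℕ.+ (b′ ∸ i)))
        ≡⟨ cong (λ x → suc (i ℕ.+ x)) (ℕₚ.+-comm (μ ℕ.* b) (b′ ∸ i)) ⟩
      suc (i ℕ.+ ((b′ ∸ i) ℕ.+ μ ℕ.* b)) ≡⟨ cong suc (ℕₚ.+-assoc i (b′ ∸ i) (μ ℕ.* b)) ⟨
      suc (i ℕ.+ (b′ ∸ i) ℕ.+ μ ℕ.* b) ≡⟨ cong (λ x → suc (x ℕ.+ μ ℕ.* b)) (ℕₚ.m+[n∸m]≡n i≤b′) ⟩
      start ∎

    i+[p+x]≡start+x : ∀ x → i ℕ.+ (p ℕ.+ x) ≡ start ℕ.+ x
    i+[p+x]≡start+x x = trans (sym (ℕₚ.+-assoc i p x)) (cong (ℕ._+ x) i+p≡start)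

    p+b≤2+e : p ℕ.+ b ≤ 2 ℕ.+ e
    p+b≤2+e = s≤s (ℕₚ.≤-trans
      (ℕₚ.+-monoˡ-≤ b (ℕₚ.+-monoʳ-≤ (μ ℕ.* b) (ℕₚ.m∸n≤m b′ i)))
      (ℕₚ.≤-trans (ℕₚ.≤-reflexive rearrange) (ℕₚ.≤-trans fits (ℕₚ.n≤1+n e))))
      where
      rearrange : μ ℕ.* b ℕ.+ b′ ℕ.+ b ≡ μ ℕ.* b ℕ.+ b ℕ.+ b′
      rearrange = trans (ℕₚ.+-assoc (μ ℕ.* b) b′ b) (trans (cong (μ ℕ.* b ℕ.+_) (ℕₚ.+-comm b′ b))
                    (sym (ℕₚ.+-assoc (μ ℕ.* b) b b′)))

    g≡0 : ∀ t → t < p ⊎ p ℕ.+ b ≤ t → g t ≡ 0#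
    g≡0 t out = trans (cong (coefficient a t *_) (outside (i ℕ.+ t) (shift out))) (zeroʳ _)
      where
      shift : t < p ⊎ p ℕ.+ b ≤ t → i ℕ.+ t < start ⊎ start ℕ.+ b ≤ i ℕ.+ t
      shift (inj₁ t<p) = inj₁ (ℕₚ.<-≤-trans (ℕₚ.+-monoʳ-< i t<p) (ℕₚ.≤-reflexive i+p≡start))
      shift (inj₂ ≤t)  = inj₂ (ℕₚ.≤-trans (ℕₚ.≤-reflexive (sym (i+[p+x]≡start+x b))) (ℕₚ.+-monoʳ-≤ i ≤t))

    -- The `suc` in `p` steps over the leading `1#`, and `inRange` keeps the index away from the
    -- trailing one.
    entry : ∀ c → coefficient a (p ℕ.+ toℕ c) ≡ toeplitz 𝔽 (window b a μ) r c
    entry c = begin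
      at (a ∷ʳ 1#) (μ ℕ.* b ℕ.+ (b′ ∸ i) ℕ.+ toℕ c)
        ≡⟨ at-∷ʳ a 1# inRange ⟩
      at a (μ ℕ.* b ℕ.+ (b′ ∸ i) ℕ.+ toℕ c)
        ≡⟨ cong (at a) (trans (ℕₚ.+-assoc (μ ℕ.* b) _ _) (cong (μ ℕ.* b ℕ.+_) (sym (ℕₚ.+-∸-comm (toℕ c) i≤b′)))) ⟩
      at a (μ ℕ.* b ℕ.+ (b′ ℕ.+ toℕ c ∸ i))
        ≡⟨ at-window b a μ (toeplitz-bound r c) ⟨
      at (window b a μ) (b′ ℕ.+ toℕ c ∸ i)
        ≡⟨ at-fromℕ< (window b a μ) (toeplitz-bound r c) ⟨
      toeplitz 𝔽 (window b a μ) r c ∎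
      where
      inRange : μ ℕ.* b ℕ.+ (b′ ∸ i) ℕ.+ toℕ c < e
      inRange = ℕₚ.<-≤-trans
        (ℕₚ.+-mono-≤-< (ℕₚ.+-monoʳ-≤ (μ ℕ.* b) (ℕₚ.m∸n≤m b′ i)) (Finₚ.toℕ<n c))
        (ℕₚ.≤-trans (ℕₚ.≤-reflexive (trans (ℕₚ.+-assoc (μ ℕ.* b) b′ b) (trans (cong (μ ℕ.* b ℕ.+_) (ℕₚ.+-comm b′ b))
                    (sym (ℕₚ.+-assoc (μ ℕ.* b) b b′))))) fits)

  middleBlock⁺ : ∀ b′ {e} (a : Vec Carrier e) μ → let b = suc b′ in μ ℕ.* b ℕ.+ b ℕ.+ b′ ≤ e →
    TrivialKernel (toeplitz 𝔽 (window b a μ)) → TrivialBlock b a (suc μ)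
  middleBlock⁺ b′ a μ fits ker Z outside conv≡0 t with position (suc μ ℕ.* suc b′) (suc b′) t
  ... | before t<            = outside t (inj₁ t<)
  ... | after ≤t             = outside t (inj₂ ≤t)
  ... | inside s s<b refl = begin
    Z (start ℕ.+ s)                       ≡⟨ cong (λ s → Z (start ℕ.+ s)) (Finₚ.toℕ-fromℕ< s<b) ⟨
    Z (start ℕ.+ toℕ (fromℕ< s<b))        ≡⟨ ker (λ c → Z (start ℕ.+ toℕ c))
      (λ r → trans (sym (convolve-toeplitz b′ a μ fits Z outside r)) (conv≡0 (toℕ r) (Finₚ.toℕ<n r))) (fromℕ< s<b) ⟩
    0# ∎
    where start = suc μ ℕ.* suc b′

  middleBlock⁻ : ∀ b′ {e} (a : Vec Carrier e) μ → let b = suc b′ in μ ℕ.* b ℕ.+ b ℕ.+ b′ ≤ e →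
    TrivialBlock b a (suc μ) → TrivialKernel (toeplitz 𝔽 (window b a μ))
  middleBlock⁻ b′ a μ fits block x Mx≡0 c = begin
    x c                       ≡⟨ Z-inside c ⟨
    Z (start ℕ.+ toℕ c)       ≡⟨ block Z outside conv≡0 (start ℕ.+ toℕ c) ⟩
    0#                        ∎
    where
    b = suc b′
    start = suc μ ℕ.* b
    -- The kernel vector `x` is moved to its block by zeros in front; behind it, `at` returns the
    -- default `0#`.
    padding = replicate start 0#
    Z : ℕ → Carrier
    Z = at (padding Vec.++ tabulate x)
    Z-inside : ∀ c → Z (start ℕ.+ toℕ c) ≡ x c
    Z-inside c = trans (at-++ʳ padding (tabulate x) (toℕ c)) (trans (at-toℕ (tabulate x) c) (Vecₚ.lookup∘tabulate x c))
    outside : ∀ t → t < start ⊎ start ℕ.+ b ≤ t → Z t ≡ 0#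
    outside t (inj₁ t<) = trans (at-++ˡ padding (tabulate x) t<) (at-replicate start t)
    outside t (inj₂ ≤t) = at-beyond (padding Vec.++ tabulate x) ≤t
    conv≡0 : ∀ i → i < b → convolve a Z i ≡ 0#
    conv≡0 i i<b = begin
      convolve a Z i                  ≡⟨ cong (convolve a Z) (Finₚ.toℕ-fromℕ< i<b) ⟨
      convolve a Z (toℕ r)            ≡⟨ convolve-toeplitz b′ a μ fits Z outside r ⟩
      (toeplitz 𝔽 (window b a μ) · (λ c → Z (start ℕ.+ toℕ c))) r
        ≡⟨ sum-cong-≗ (λ c → cong (toeplitz 𝔽 (window b a μ) r c *_) (Z-inside c)) ⟩
      (toeplitz 𝔽 (window b a μ) · x) r ≡⟨ Mx≡0 r ⟩
      0#                              ∎
      where r = fromℕ< i<b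

-- Paths as linked vectors, and the gluing of overlapping windows

linked-lookup : ∀ {A : Set} {R : Rel A 0ℓ} {l} {xs : Vec A (suc l)} → Linked R xs →
  ∀ (m : Fin l) → R (lookup xs (inject₁ m)) (lookup xs (suc m))
linked-lookup {xs = _ ∷ _ ∷ _} (r ∷ _)  zero    = r
linked-lookup {xs = _ ∷ _ ∷ _} (_ ∷ rs) (suc m) = linked-lookup rs m

linked-tabulate : ∀ {A : Set} {R : Rel A 0ℓ} {l} (f : Fin (suc l) → A) →
  (∀ m → R (f (inject₁ m)) (f (suc m))) → Linked R (tabulate f)
linked-tabulate {l = zero}  f r = [-]
linked-tabulate {l = suc l} f r = r zero ∷ linked-tabulate (f ∘ suc) (r ∘ suc)

pointwise-tabulateˡ : ∀ {A B : Set} {_∼_ : REL A B 0ℓ} {n} (f : Fin n → A) (ys : Vec B n) →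
  (∀ i → f i ∼ lookup ys i) → Pointwise _∼_ (tabulate f) ys
pointwise-tabulateˡ f []       _ = []
pointwise-tabulateˡ f (y ∷ ys) r = r zero ∷ pointwise-tabulateˡ (f ∘ suc) ys (r ∘ suc)

list⇒vec : ∀ {A : Set} {n} (xs : List A) → List.length xs ≡ n → ∃[ v ] toList {A = A} {n} v ≡ xs
list⇒vec xs refl = Vec.fromList xs , Vecₚ.toList∘fromList xs

module Gluing {A : Set} (b : ℕ) where

  -- Each window supplies its first `b` letters and the last window all the remaining ones. This
  -- makes sense for arbitrary windows; agreement on overlaps enters only when windows are read
  -- back.
  glue : ∀ {l} → (Fin (suc l) → ℕ → A) → ℕ → A
  glue {zero}  W t = W zero t
  glue {suc l} W t with t ℕₚ.<? b
  ... | yes _ = W zero t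
  ... | no  _ = glue (W ∘ suc) (t ∸ b)

  glue-head : ∀ {l} (W : Fin (suc l) → ℕ → A) {t} → t < b → glue W t ≡ W zero t
  glue-head {zero}  W     t<b = refl
  glue-head {suc l} W {t} t<b with t ℕₚ.<? b
  ... | yes _   = refl
  ... | no  t≮b with () ← t≮b t<b

  glue-tail : ∀ {l} (W : Fin (suc (suc l)) → ℕ → A) t → glue W (b ℕ.+ t) ≡ glue (W ∘ suc) t
  glue-tail W t with (b ℕ.+ t) ℕₚ.<? b
  ... | yes b+t<b with () ← ℕₚ.m+n≮m b t b+t<b
  ... | no  _     = cong (glue (W ∘ suc)) (ℕₚ.m+n∸m≡n b t)

  -- Since `s ≤ b`, the letters of a window past position `b` lie among the first `b` letters of the
  -- next window, so agreement of consecutive windows is enough.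
  glue-window : ∀ {l s} (W : Fin (suc l) → ℕ → A) → s ≤ b →
    (∀ m {p} → p < s → W (inject₁ m) (b ℕ.+ p) ≡ W (suc m) p) →
    ∀ m {p} → p < b ℕ.+ s → glue W (toℕ m ℕ.* b ℕ.+ p) ≡ W m p
  glue-window {zero}  W s≤b agree zero p< = refl
  glue-window {suc l} {s} W s≤b agree zero {p} p< with position 0 b p
  ... | before ()
  ... | inside _ p<b refl = glue-head W p<b
  ... | after b≤p = begin
    glue W p               ≡⟨ cong (glue W) eq ⟨
    glue W (b ℕ.+ (p ∸ b)) ≡⟨ glue-tail W (p ∸ b) ⟩
    glue (W ∘ suc) (p ∸ b) ≡⟨ glue-head (W ∘ suc) (ℕₚ.<-≤-trans p∸b<s s≤b) ⟩
    W (suc zero) (p ∸ b)   ≡⟨ agree zero p∸b<s ⟨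
    W zero (b ℕ.+ (p ∸ b)) ≡⟨ cong (W zero) eq ⟩
    W zero p               ∎
    where
    open ≡-Reasoning
    eq = ℕₚ.m+[n∸m]≡n b≤p
    p∸b<s : p ∸ b < s
    p∸b<s = ℕₚ.+-cancelˡ-< b _ _ (ℕₚ.≤-<-trans (ℕₚ.≤-reflexive eq) p<)
  glue-window {suc l} W s≤b agree (suc m) {p} p< = begin
    glue W (b ℕ.+ toℕ m ℕ.* b ℕ.+ p)   ≡⟨ cong (glue W) (ℕₚ.+-assoc b _ p) ⟩
    glue W (b ℕ.+ (toℕ m ℕ.* b ℕ.+ p)) ≡⟨ glue-tail W _ ⟩
    glue (W ∘ suc) (toℕ m ℕ.* b ℕ.+ p) ≡⟨ glue-window (W ∘ suc) s≤b (agree ∘ suc) m p< ⟩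
    W (suc m) p                        ∎
    where open ≡-Reasoning

  -- The stride `b` is subtracted until the position falls into a window. With `s = b ∸ 1` and `b`
  -- positive, the length `s + 1 * b` is what `2 * b ∸ 1` computes to.
  covering : ∀ l s {t} → t < s ℕ.+ suc l ℕ.* b →
    ∃[ m ] ∃[ p ] p < s ℕ.+ 1 ℕ.* b × t ≡ toℕ {suc l} m ℕ.* b ℕ.+ p
  covering zero    s {t} t< = zero , t , t< , refl
  covering (suc l) s {t} t< with ℕₚ.<-≤-connex t b
  ... | inj₁ t<b = zero , t , ℕₚ.<-≤-trans t<b (ℕₚ.≤-trans (ℕₚ.m≤m+n b 0) (ℕₚ.m≤n+m _ s)) , refl
  ... | inj₂ b≤t =
    let m , p , p< , eq = covering l s (ℕₚ.+-cancelˡ-< b _ _ (ℕₚ.≤-<-trans (ℕₚ.≤-reflexive (ℕₚ.m+[n∸m]≡n b≤t))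
                            (ℕₚ.<-≤-trans t< (ℕₚ.≤-reflexive swap))))
    in suc m , p , p< , trans (sym (ℕₚ.m+[n∸m]≡n b≤t)) (trans (cong (b ℕ.+_) eq) (sym (ℕₚ.+-assoc b _ p)))
    where
    swap : s ℕ.+ (b ℕ.+ suc l ℕ.* b) ≡ b ℕ.+ (s ℕ.+ suc l ℕ.* b)
    swap = trans (sym (ℕₚ.+-assoc s b _)) (trans (cong (ℕ._+ suc l ℕ.* b) (ℕₚ.+-comm s b)) (ℕₚ.+-assoc b s _))

-- Lines of the hypercube against blocks, and fusion as overlap

module Correspondence {q} (𝔽 : FiniteField q) where
  open FiniteField 𝔽
  open CommutativeRing commutativeRing
    using (+-identityˡ; +-identityʳ; *-identityˡ; zeroʳ)
  open Nonsingular 𝔽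
  open Automata 𝔽
  open ≡-Reasoning

  module Lines {b k} (Ψ : Fin (q ^ b) ↔ Vec Carrier b) {e} (eq : b ℕ.+ (2 ℕ.+ e) ≡ suc (k ℕ.* b)) (a : Vec Carrier e)
    {F : Vec Carrier (k ℕ.* b) → Vec Carrier b} (F≗CA : F ≗ cellularAutomaton eq (bipermutiveRule 𝔽 a)) where
    module Ψ = Inverse Ψ

    from-injective : ∀ {v w} → Ψ.from v ≡ Ψ.from w → v ≡ w
    from-injective = Injection.injective (↔⇒↣ (↔-sym Ψ))

    to-injective : ∀ {x y} → Ψ.to x ≡ Ψ.to y → x ≡ y
    to-injective = Injection.injective (↔⇒↣ Ψ)

    line : Vec (Fin (q ^ b)) k → Fin k → Fin (q ^ b) → Vec Carrier (k ℕ.* b)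
    line i j x = concat (Vec.map Ψ.to (i [ j ]≔ x))

    line-inside : ∀ i j x {s} → s < b → at (line i j x) (toℕ j ℕ.* b ℕ.+ s) ≡ at (Ψ.to x) s
    line-inside i j x {s} s<b = begin
      at (line i j x) (toℕ j ℕ.* b ℕ.+ s)
        ≡⟨ cong (λ v → at (concat v) (toℕ j ℕ.* b ℕ.+ s)) (Vecₚ.map-[]≔ Ψ.to i j) ⟩
      at (concat (Vec.map Ψ.to i [ j ]≔ Ψ.to x)) (toℕ j ℕ.* b ℕ.+ s)
        ≡⟨ at-concat-update (Vec.map Ψ.to i) j (Ψ.to x) s<b ⟩
      at (Ψ.to x) s ∎

    line-outside : ∀ i j x y {t} → t < toℕ j ℕ.* b ⊎ toℕ j ℕ.* b ℕ.+ b ≤ t →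
      at (line i j x) t ≡ at (line i j y) t
    line-outside i j x y {t} out = begin
      at (line i j x) t ≡⟨ cong (λ v → at (concat v) t) (Vecₚ.map-[]≔ Ψ.to i j) ⟩
      at (concat (Vec.map Ψ.to i [ j ]≔ Ψ.to x)) t
        ≡⟨ at-concat-fixed (Vec.map Ψ.to i) j (Ψ.to x) (Ψ.to y) out ⟩
      at (concat (Vec.map Ψ.to i [ j ]≔ Ψ.to y)) t
        ≡⟨ cong (λ v → at (concat v) t) (Vecₚ.map-[]≔ Ψ.to i j) ⟨
      at (line i j y) t ∎

    F-convolve : ∀ v (r : Fin b) → lookup (F v) r ≡ convolve a (at v) (toℕ r)
    F-convolve v r = trans (cong (λ w → lookup w r) (F≗CA v)) (CA-convolve eq a v r)

    -- One line suffices, the one through the zero input. Its points with block `y`, cut out of `Z`,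
    -- and with zero block `o` differ by `Z`, so they have equal images, and injectivity along the
    -- axis gives `y ≡ o`.
    latin⇒trivialBlock : IsLatinHypercube (associatedHypercube 𝔽 {b} {k} Ψ F) → ∀ j → TrivialBlock b a (toℕ j)
    latin⇒trivialBlock latin j Z outside conv≡0 = Z≡0
      where
      start = toℕ j ℕ.* b
      y o : Vec Carrier b
      y = tabulate λ c → Z (start ℕ.+ toℕ c)
      o = replicate b 0#
      i = replicate k (Ψ.from o)
      X X′ : ℕ → Carrier
      X  = at (line i j (Ψ.from y))
      X′ = at (line i j (Ψ.from o))

      at-y : ∀ {s} → s < b → at y s ≡ Z (start ℕ.+ s)
      at-y = at-tabulate (λ c → Z (start ℕ.+ c))

      decompose : ∀ t → X t ≡ X′ t + 1# * Z t
      decompose t with position start b t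
      ... | before t< = trans (line-outside i j _ _ (inj₁ t<))
              (sym (trans (cong (λ z → X′ t + 1# * z) (outside t (inj₁ t<))) (trans (cong (X′ t +_) (zeroʳ 1#)) (+-identityʳ _))))
      ... | after ≤t  = trans (line-outside i j _ _ (inj₂ ≤t))
              (sym (trans (cong (λ z → X′ t + 1# * z) (outside t (inj₂ ≤t))) (trans (cong (X′ t +_) (zeroʳ 1#)) (+-identityʳ _))))
      ... | inside s s<b refl = begin
        X (start ℕ.+ s)              ≡⟨ line-inside i j (Ψ.from y) s<b ⟩
        at (Ψ.to (Ψ.from y)) s       ≡⟨ cong (λ v → at v s) (Ψ.strictlyInverseˡ y) ⟩
        at y s                       ≡⟨ at-y s<b ⟩
        Z (start ℕ.+ s)              ≡⟨ *-identityˡ _ ⟨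
        1# * Z (start ℕ.+ s)         ≡⟨ +-identityˡ _ ⟨
        0# + 1# * Z (start ℕ.+ s)    ≡⟨ cong (_+ 1# * Z (start ℕ.+ s)) (at-replicate b s) ⟨
        at o s + 1# * Z (start ℕ.+ s)
          ≡⟨ cong (λ v → at v s + 1# * Z (start ℕ.+ s)) (Ψ.strictlyInverseˡ o) ⟨
        at (Ψ.to (Ψ.from o)) s + 1# * Z (start ℕ.+ s)
          ≡⟨ cong (_+ 1# * Z (start ℕ.+ s)) (line-inside i j (Ψ.from o) s<b) ⟨
        X′ (start ℕ.+ s) + 1# * Z (start ℕ.+ s) ∎

      F-equal : F (line i j (Ψ.from y)) ≡ F (line i j (Ψ.from o))
      F-equal = lookup-extensional λ r → begin
        lookup (F (line i j (Ψ.from y))) r ≡⟨ F-convolve _ r ⟩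
        convolve a X (toℕ r)               ≡⟨ convolve-cong a decompose (toℕ r) ⟩
        convolve a (λ t → X′ t + 1# * Z t) (toℕ r) ≡⟨ convolve-combine a X′ 1# Z (toℕ r) ⟩
        convolve a X′ (toℕ r) + 1# * convolve a Z (toℕ r)
          ≡⟨ cong (λ z → convolve a X′ (toℕ r) + 1# * z) (conv≡0 (toℕ r) (Finₚ.toℕ<n r)) ⟩
        convolve a X′ (toℕ r) + 1# * 0#    ≡⟨ cong (convolve a X′ (toℕ r) +_) (zeroʳ 1#) ⟩
        convolve a X′ (toℕ r) + 0#         ≡⟨ +-identityʳ _ ⟩
        convolve a X′ (toℕ r)              ≡⟨ F-convolve _ r ⟨
        lookup (F (line i j (Ψ.from o))) r ∎

      y≡o : y ≡ o
      y≡o = from-injective (proj₁ (latin j i) (cong Ψ.from F-equal))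

      Z≡0 : ∀ t → Z t ≡ 0#
      Z≡0 t with position start b t
      ... | before t<         = outside t (inj₁ t<)
      ... | after ≤t          = outside t (inj₂ ≤t)
      ... | inside s s<b refl = trans (sym (at-y s<b)) (trans (cong (λ v → at v s) y≡o) (at-replicate b s))

    -- Two inputs on a line differ only within block `j`; if their images agree, the difference lies
    -- in the kernel of that block.
    trivialBlock⇒latin : (∀ j → TrivialBlock b a (toℕ j)) → IsLatinHypercube (associatedHypercube 𝔽 {b} {k} Ψ F)
    trivialBlock⇒latin blocks j i =
      injective , strictlySurjective⇒surjective (Fin-injective⇒surjective _ injective)
      where
      injective : ∀ {x y} → associatedHypercube 𝔽 {b} {k} Ψ F (i [ j ]≔ x) ≡ associatedHypercube 𝔽 {b} {k} Ψ F (i [ j ]≔ y) → x ≡ y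
      injective {x} {y} H≡ = to-injective (at-extensional λ {s} s<b → begin
        at (Ψ.to x) s                        ≡⟨ line-inside i j x s<b ⟨
        X (toℕ j ℕ.* b ℕ.+ s)                ≡⟨ x+-1*y≡0⇒x≡y (blocks j Z outside conv≡0 _) ⟩
        Y (toℕ j ℕ.* b ℕ.+ s)                ≡⟨ line-inside i j y s<b ⟩
        at (Ψ.to y) s                        ∎)
        where
        X Y Z : ℕ → Carrier
        X = at (line i j x)
        Y = at (line i j y)
        Z t = X t + - 1# * Y t
        outside : ∀ t → t < toℕ j ℕ.* b ⊎ toℕ j ℕ.* b ℕ.+ b ≤ t → Z t ≡ 0#
        outside t out = trans (cong (_+ - 1# * Y t) (line-outside i j x y out)) (x+-1*x≡0 (Y t))
        conv≡ : ∀ r → convolve a X (toℕ {b} r) ≡ convolve a Y (toℕ r)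
        conv≡ r = begin
          convolve a X (toℕ r)    ≡⟨ F-convolve (line i j x) r ⟨
          lookup (F (line i j x)) r ≡⟨ cong (λ v → lookup v r) (from-injective H≡) ⟩
          lookup (F (line i j y)) r ≡⟨ F-convolve (line i j y) r ⟩
          convolve a Y (toℕ r)    ∎
        conv≡0 : ∀ r → r < b → convolve a Z r ≡ 0#
        conv≡0 r r<b = begin
          convolve a Z r                             ≡⟨ convolve-combine a X (- 1#) Y r ⟩
          convolve a X r + - 1# * convolve a Y r     ≡⟨ cong (_+ - 1# * convolve a Y r)
            (subst (λ r → convolve a X r ≡ convolve a Y r) (Finₚ.toℕ-fromℕ< r<b) (conv≡ (fromℕ< r<b))) ⟩
          convolve a Y r + - 1# * convolve a Y r     ≡⟨ x+-1*x≡0 _ ⟩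
          0#                                         ∎

  -- The length of `u` forces `u₀` to have length `b`, so the common factor `x` starts at position
  -- `b` of `u` and at position 0 of `v`.
  fusion⇒overlap : ∀ b {m n} {u : Vec Carrier m} {v : Vec Carrier n} {s z} → m ≡ s ℕ.+ b →
    Fusion s (toList u) (toList v) z → ∀ {p} → p < s → at u (b ℕ.+ p) ≡ at v p
  fusion⇒overlap b {m} {u = u} {v} {s} m≡ (x , u₀ , v₀ , |x|≡s , u≡ , v≡ , _) {p} p<s = begin
    nth (toList u) (b ℕ.+ p)                   ≡⟨ cong₂ nth u≡ (cong (ℕ._+ p) (sym |u₀|≡b)) ⟩
    nth (u₀ List.++ x) (List.length u₀ ℕ.+ p)  ≡⟨ nth-++ʳ u₀ p ⟩
    nth x p                                    ≡⟨ nth-++ˡ x (subst (p <_) (sym |x|≡s) p<s) ⟨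
    nth (x List.++ v₀) p                       ≡⟨ cong (λ v → nth v p) v≡ ⟨
    nth (toList v) p                           ∎
    where
    |u₀|≡b : List.length u₀ ≡ b
    |u₀|≡b = ℕₚ.+-cancelʳ-≡ s _ _ (begin
      List.length u₀ ℕ.+ s               ≡⟨ cong (List.length u₀ ℕ.+_) |x|≡s ⟨
      List.length u₀ ℕ.+ List.length x   ≡⟨ Listₚ.length-++ u₀ ⟨
      List.length (u₀ List.++ x)         ≡⟨ cong List.length u≡ ⟨
      List.length (toList u)             ≡⟨ Vecₚ.length-toList u ⟩
      m                                  ≡⟨ m≡ ⟩
      s ℕ.+ b                            ≡⟨ ℕₚ.+-comm s b ⟩
      b ℕ.+ s                            ∎)

  -- Cut `u` at `b` and `v` at `s`: letterwise agreement identifies the two pieces of length `s`,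
  -- which serve as `x`.
  overlap⇒fusion : ∀ b {m n l s} {u : Vec Carrier m} {v : Vec Carrier n} → m ≡ s ℕ.+ b → s ≤ n → b ℕ.+ n ≡ l →
    (∀ {p} → p < s → at u (b ℕ.+ p) ≡ at v p) →
    Σ[ z ∈ Vec Carrier l ] Fusion s (toList u) (toList v) (toList z)
  overlap⇒fusion b {m} {n} {l} {s} {u} {v} m≡ s≤n b+n≡l agree =
    let z , z≡ = list⇒vec (u₀ List.++ x List.++ v₀) |z|≡l
    in z , x , u₀ , v₀ , |x|≡s , sym (Listₚ.take++drop≡id b us) , v≡ , z≡
    where
    us = toList u
    vs = toList v
    u₀ = List.take b us
    x  = List.drop b us
    v₀ = List.drop s vs
    |us|≡ : List.length us ≡ m
    |us|≡ = Vecₚ.length-toList u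
    |vs|≡ : List.length vs ≡ n
    |vs|≡ = Vecₚ.length-toList v
    |u₀|≡b : List.length u₀ ≡ b
    |u₀|≡b = trans (Listₚ.length-take b us) (ℕₚ.m≤n⇒m⊓n≡m (subst (b ≤_) (sym (trans |us|≡ m≡)) (ℕₚ.m≤n+m b s)))
    |x|≡s : List.length x ≡ s
    |x|≡s = trans (Listₚ.length-drop b us) (trans (cong (_∸ b) (trans |us|≡ m≡)) (ℕₚ.m+n∸n≡m s b))
    |take| : List.length (List.take s vs) ≡ s
    |take| = trans (Listₚ.length-take s vs) (ℕₚ.m≤n⇒m⊓n≡m (subst (s ≤_) (sym |vs|≡) s≤n))
    x≡ : x ≡ List.take s vs
    x≡ = nth-extensional x (List.take s vs) (trans |x|≡s (sym |take|)) λ {t} t<|x| →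
      let t<s = subst (t <_) |x|≡s t<|x| in begin
      nth x t                                     ≡⟨ nth-++ʳ u₀ t ⟨
      nth (u₀ List.++ x) (List.length u₀ ℕ.+ t)
        ≡⟨ cong₂ nth (Listₚ.take++drop≡id b us) (cong (ℕ._+ t) |u₀|≡b) ⟩
      nth us (b ℕ.+ t)                            ≡⟨ agree t<s ⟩
      nth vs t
        ≡⟨ cong (λ w → nth w t) (Listₚ.take++drop≡id s vs) ⟨
      nth (List.take s vs List.++ v₀) t
        ≡⟨ nth-++ˡ (List.take s vs) (subst (t <_) (sym |take|) t<s) ⟩
      nth (List.take s vs) t                      ∎
    v≡ : vs ≡ x List.++ v₀
    v≡ = trans (sym (Listₚ.take++drop≡id s vs)) (cong (List._++ v₀) (sym x≡))
    |z|≡l : List.length (u₀ List.++ x List.++ v₀) ≡ l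
    |z|≡l = begin
      List.length (u₀ List.++ x List.++ v₀)  ≡⟨ cong (λ w → List.length (u₀ List.++ w)) v≡ ⟨
      List.length (u₀ List.++ vs)            ≡⟨ Listₚ.length-++ u₀ ⟩
      List.length u₀ ℕ.+ List.length vs      ≡⟨ cong₂ ℕ._+_ |u₀|≡b |vs|≡ ⟩
      b ℕ.+ n                                ≡⟨ b+n≡l ⟩
      l                                      ∎

  -- Bijections of Latin automata and of paths with coefficient words

  module Count (b′ l : ℕ) where
    private
      b = suc b′
      k = 3 ℕ.+ l
      -- The rule has `2 + e = b (k - 1) + 1` variables, so `e = b (l + 2) - 1` for `k = 3 + l`.
      -- Exactly `l + 1` windows of length `2 b - 1` at stride `b` fit, and they cover the word.
      e = b′ ℕ.+ suc l ℕ.* b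

    open Gluing {Carrier} b

    WindowsNonsingular : Vec Carrier e → Set
    WindowsNonsingular a = ∀ (μ : Fin (suc l)) → det 𝔽 b (window b a (toℕ μ)) ≢ 0#

    Rules : Setoid 0ℓ 0ℓ
    Rules = Subtype (Vec Carrier e) WindowsNonsingular

    rules-finite : ∃[ L ] HasCardinality Rules L
    rules-finite = subtype-finite (Vec-finite finite e)
      λ a → Finₚ.all? λ μ → ¬? (det 𝔽 b (window b a (toℕ μ)) ≟ 0#)

    arity : b ℕ.+ (2 ℕ.+ e) ≡ suc (k ℕ.* b)
    arity = cong suc (ℕₚ.+-suc b′ (suc e))

    arity-unique : ∀ {e′} → b ℕ.+ (2 ℕ.+ e′) ≡ suc (k ℕ.* b) → e′ ≡ e
    arity-unique {e′} eq = ℕₚ.suc-injective (ℕₚ.suc-injective (ℕₚ.+-cancelˡ-≡ b _ _ (trans eq (sym arity))))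

    window-fits : ∀ {μ} → μ ≤ l → μ ℕ.* b ℕ.+ b ℕ.+ b′ ≤ e
    window-fits {μ} μ≤l = ℕₚ.≤-trans (ℕₚ.≤-reflexive (trans (ℕₚ.+-comm _ b′) (cong (b′ ℕ.+_) (ℕₚ.+-comm (μ ℕ.* b) b))))
      (ℕₚ.+-monoʳ-≤ b′ (ℕₚ.*-monoˡ-≤ b (s≤s μ≤l)))

    window-injective : ∀ {a a′ : Vec Carrier e} →
      (∀ (μ : Fin (suc l)) → window b a (toℕ μ) ≡ window b a′ (toℕ μ)) → a ≡ a′
    window-injective {a} {a′} eq = at-extensional λ t<e →
      let μ , p , p< , t≡ = covering l b′ t<e in begin
      at a _                           ≡⟨ cong (at a) t≡ ⟩
      at a (toℕ μ ℕ.* b ℕ.+ p)         ≡⟨ at-window b a (toℕ μ) p< ⟨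
      at (window b a (toℕ μ)) p        ≡⟨ cong (λ w → at w p) (eq μ) ⟩
      at (window b a′ (toℕ μ)) p       ≡⟨ at-window b a′ (toℕ μ) p< ⟩
      at a′ (toℕ μ ℕ.* b ℕ.+ p)        ≡⟨ cong (at a′) t≡ ⟨
      at a′ _                          ∎

    module _ (Ψ : Fin (q ^ b) ↔ Vec Carrier b) {F : Vec Carrier (k ℕ.* b) → Vec Carrier b}
      (a : Vec Carrier e) (F≗CA : F ≗ cellularAutomaton arity (bipermutiveRule 𝔽 a)) where
      open Lines {b} {k} Ψ arity a F≗CA

      latin⇒nonsingular : IsLatinHypercube (associatedHypercube 𝔽 {b} {k} Ψ F) → WindowsNonsingular a
      latin⇒nonsingular latin μ = trivialKernel⇒det≢0 b {toeplitz 𝔽 (window b a (toℕ μ))}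
        (middleBlock⁻ b′ a (toℕ μ) (window-fits (Finₚ.toℕ≤pred[n] μ))
          (subst (TrivialBlock b a) (cong suc (Finₚ.toℕ-inject₁ μ)) (latin⇒trivialBlock latin (suc (inject₁ μ)))))

      nonsingular⇒latin : WindowsNonsingular a → IsLatinHypercube (associatedHypercube 𝔽 {b} {k} Ψ F)
      nonsingular⇒latin nonsingular = trivialBlock⇒latin block
        where
        block : ∀ j → TrivialBlock b a (toℕ {k} j)
        block zero    = firstBlock b a
        block (suc j) with ℕₚ.m≤n⇒m<n∨m≡n (Finₚ.toℕ≤pred[n] j)
        -- Block `2 + l` starts at `(2 + l) * b`, which computes to `suc e`.
        ... | inj₂ j≡1+l = subst (TrivialBlock b a) (cong suc (sym j≡1+l)) (lastBlock b a (2 ℕ.+ l) refl)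
        ... | inj₁ j<1+l = subst (TrivialBlock b a) (cong suc (Finₚ.toℕ-fromℕ< j<1+l))
          (middleBlock⁺ b′ a (toℕ μ) (window-fits (Finₚ.toℕ≤pred[n] μ))
            (det≢0⇒trivialKernel {M = toeplitz 𝔽 (window b a (toℕ μ))} (nonsingular μ)))
          where μ = fromℕ< j<1+l

    latinLBCA↔rules : (Ψ : Fin (q ^ b) ↔ Vec Carrier b) → Inverse (LatinLBCA 𝔽 b k Ψ) Rules
    latinLBCA↔rules Ψ = mkInverse {LatinLBCA 𝔽 b k Ψ} {Rules}
      (λ (F , lbca , latin) → rule lbca , latin⇒nonsingular Ψ (rule lbca) (F≗rule lbca) latin)
      (λ (a , nonsingular) → automaton a , (e , arity , a , λ _ → refl) , nonsingular⇒latin Ψ a (λ _ → refl) nonsingular)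
      (λ {(F , lbca , _)} {(F′ , lbca′ , _)} F≗F′ → CA-injective arity (rule lbca) (rule lbca′) λ x →
        trans (sym (F≗rule lbca x)) (trans (F≗F′ x) (F≗rule lbca′ x)))
      (λ { refl x → refl })
      (λ (a , _) → Vecₚ.cast-is-id _ a)
      (λ (F , lbca , _) x → sym (F≗rule lbca x))
      where
      automaton : Vec Carrier e → Vec Carrier (k ℕ.* b) → Vec Carrier b
      automaton a = cellularAutomaton arity (bipermutiveRule 𝔽 a)
      rule : ∀ {F : Vec Carrier (k ℕ.* b) → Vec Carrier b} → IsLBCA 𝔽 F → Vec Carrier e
      rule (_ , eq , a , _) = Vec.cast (arity-unique eq) a
      F≗rule : ∀ {F : Vec Carrier (k ℕ.* b) → Vec Carrier b} (lbca : IsLBCA 𝔽 F) → F ≗ automaton (rule lbca)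
      F≗rule (_ , eq , a , F≗) x = trans (F≗ x) (CA-irrelevant (arity-unique eq) eq arity a x)

    private
      w = 2 ℕ.* b ∸ 1

      w≡ : w ≡ b′ ℕ.+ b
      w≡ = cong (b′ ℕ.+_) (ℕₚ.+-identityʳ b)

      <w : ∀ {p} → p < b ℕ.+ b′ → p < w
      <w p< = ℕₚ.<-≤-trans p< (ℕₚ.≤-reflexive (trans (ℕₚ.+-comm b b′) (sym w≡)))

      <b+b′ : ∀ {p} → p < w → p < b ℕ.+ b′
      <b+b′ p< = ℕₚ.<-≤-trans p< (ℕₚ.≤-reflexive (trans w≡ (ℕₚ.+-comm b′ b)))

    open Digraph (deBruijnGraph 𝔽 b) using (Edge)

    edge⇒overlap : ∀ {u v} → Edge u v → ∀ {p} → p < b′ → at (proj₁ u) (b ℕ.+ p) ≡ at (proj₁ v) p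
    edge⇒overlap {u} {v} (_ , fusion) = fusion⇒overlap b {u = proj₁ u} {proj₁ v} w≡ fusion

    -- The end of one window and the beginning of the next both read `a` from position `suc μ * b`
    -- onwards.
    window-edge : ∀ (a : Vec Carrier e) μ {p p′} → Edge (window b a μ , p) (window b a (suc μ) , p′)
    window-edge a μ = overlap⇒fusion b {u = window b a μ} {window b a (suc μ)} w≡
      (ℕₚ.m≤m+n b′ _) lengths λ {p} p<b′ → begin
        at (window b a μ) (b ℕ.+ p)        ≡⟨ at-window b a μ (<w (ℕₚ.+-monoʳ-< b p<b′)) ⟩
        at a (μ ℕ.* b ℕ.+ (b ℕ.+ p))       ≡⟨ cong (at a) (ℕₚ.+-assoc (μ ℕ.* b) b p) ⟨
        at a (μ ℕ.* b ℕ.+ b ℕ.+ p)         ≡⟨ cong (λ n → at a (n ℕ.+ p)) (ℕₚ.+-comm (μ ℕ.* b) b) ⟩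
        at a (suc μ ℕ.* b ℕ.+ p)
          ≡⟨ at-window b a (suc μ) (ℕₚ.<-≤-trans p<b′ (ℕₚ.m≤m+n b′ _)) ⟨
        at (window b a (suc μ)) p          ∎
      where
      lengths : b ℕ.+ w ≡ 3 ℕ.* b ∸ 1
      lengths = sym (ℕₚ.+-suc b′ w)

    glued : Vec (Supp 𝔽 b) (suc l) → Vec Carrier e
    glued vs = tabulate (glue (λ m → at (proj₁ (lookup vs m))) ∘ toℕ)

    -- Reading the vertices back makes the glued word a rule and recovers the path from it; together
    -- with `window-injective` it also recovers a rule from its path.
    window-glued : ∀ {vs} → Linked Edge vs → ∀ μ → window b (glued vs) (toℕ μ) ≡ proj₁ (lookup vs μ)
    window-glued {vs} linked μ = at-extensional λ {p} p<w → begin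
      at (window b (glued vs) (toℕ μ)) p     ≡⟨ at-window b (glued vs) (toℕ μ) p<w ⟩
      at (glued vs) (toℕ μ ℕ.* b ℕ.+ p)      ≡⟨ at-tabulate (glue W) (bound p<w) ⟩
      glue W (toℕ μ ℕ.* b ℕ.+ p)               ≡⟨ glue-window W (ℕₚ.n≤1+n b′)
        (λ m → edge⇒overlap {lookup vs (inject₁ m)} {lookup vs (suc m)} (linked-lookup linked m)) μ (<b+b′ p<w) ⟩
      at (proj₁ (lookup vs μ)) p               ∎
      where
      W : Fin (suc l) → ℕ → Carrier
      W m = at (proj₁ (lookup vs m))
      bound : ∀ {p} → p < w → toℕ μ ℕ.* b ℕ.+ p < e
      bound p<w = ℕₚ.<-≤-trans (ℕₚ.+-monoʳ-< (toℕ μ ℕ.* b) (<b+b′ p<w))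
        (ℕₚ.≤-trans (ℕₚ.≤-reflexive (sym (ℕₚ.+-assoc (toℕ μ ℕ.* b) b b′))) (window-fits (Finₚ.toℕ≤pred[n] μ)))

    paths↔rules : Inverse (Paths (deBruijnGraph 𝔽 b) l) Rules
    paths↔rules = mkInverse {Paths (deBruijnGraph 𝔽 b) l} {Rules}
      (λ (vs , linked) → fromPath vs linked)
      (λ rule → vertices rule , linked-tabulate (vertexAt rule) (edge rule))
      (λ {(vs , linked)} {(vs′ , linked′)} vs≋vs′ → window-injective λ μ → begin
        window b (glued vs) (toℕ μ)   ≡⟨ window-glued linked μ ⟩
        proj₁ (lookup vs μ)             ≡⟨ Pointwise.lookup vs≋vs′ μ ⟩
        proj₁ (lookup vs′ μ)            ≡⟨ window-glued linked′ μ ⟨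
        window b (glued vs′) (toℕ μ)  ∎)
      (λ {rule} {rule′} eq → pointwise-tabulateˡ (vertexAt rule) (vertices rule′) λ μ →
        trans (cong (λ a → window b a (toℕ μ)) eq) (sym (vertex rule′ μ)))
      (λ rule → window-injective λ μ → trans (window-glued (linked-tabulate (vertexAt rule) (edge rule)) μ) (vertex rule μ))
      (λ (vs , linked) → pointwise-tabulateˡ (vertexAt (fromPath vs linked)) vs (window-glued linked))
      where
      fromPath : ∀ vs → Linked Edge vs → Setoid.Carrier Rules
      fromPath vs linked = glued vs , λ μ →
        subst (λ v → det 𝔽 b v ≢ 0#) (sym (window-glued linked μ)) (proj₂ (lookup vs μ))
      vertexAt : (rule : Setoid.Carrier Rules) → Fin (suc l) → Supp 𝔽 b
      vertexAt (a , nonsingular) μ = window b a (toℕ μ) , nonsingular μ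
      vertices : Setoid.Carrier Rules → Vec (Supp 𝔽 b) (suc l)
      vertices rule = tabulate (vertexAt rule)
      vertex : ∀ rule μ → proj₁ (lookup (vertices rule) μ) ≡ window b (proj₁ rule) (toℕ μ)
      vertex rule μ = cong proj₁ (Vecₚ.lookup∘tabulate (vertexAt rule) μ)
      edge : ∀ rule m → Edge (vertexAt rule (inject₁ m)) (vertexAt rule (suc m))
      -- `toℕ (inject₁ m)` equals `toℕ m` only propositionally. Quantifying over `p` allows the
      -- index to be transported without the nonsingularity proof that depends on it.
      edge (a , nonsingular) m = subst (λ μ → ∀ {p} → Edge (window b a μ , p) (vertexAt (a , nonsingular) (suc m)))
        (sym (Finₚ.toℕ-inject₁ m)) (λ {p} → window-edge a (toℕ m) {p} {nonsingular (suc m)}) {nonsingular (inject₁ m)}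

theorem3 : ∀ {q} → IsPrimePower q → (𝔽 : FiniteField q) →
    let open FiniteField 𝔽 using (Carrier) in
    ∀ b k → NonZero b → 3 ≤ k →
    (_≼_ : Rel (Vec Carrier b) 0ℓ) → IsTotalOrder _≡_ _≼_ →
    (Ψ : Fin (q ^ b) ↔ Vec Carrier b) → Monotonic₁ Fin._≤_ _≼_ (Inverse.to Ψ) →
    ∃[ L ] HasCardinality (LatinLBCA 𝔽 b k Ψ) L ×
    HasCardinality (Paths (deBruijnGraph 𝔽 b) (k ∸ 3)) L
theorem3 _ 𝔽 (suc b′) (suc (suc (suc l))) _ (s≤s (s≤s (s≤s z≤n))) _ _ Ψ _ =
  let L , count = rules-finite
  in L , Composition.inverse (latinLBCA↔rules Ψ) count , Composition.inverse paths↔rules count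
  where open Correspondence.Count 𝔽 b′ l
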